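{- There is an absolute constant $C>0$ such that for all positive integers $n, f, k$, every $n$-node graph $G=(V,E)$ with edge lengths $w:E\to\mathbb{R}_{\ge 0}$ has an $f$-edge fault tolerant $(2k-1)$-spanner $H$ with $$|E(H)| \le \begin{cases} C\left(k^2 f^{1/2-1/(2k)} n^{1+1/k} + kfn\right) & \text{if } k \text{ is odd},\\ C\left(k^2 f^{1/2} n^{1+1/k} + kfn\right) & \text{if } k \text{ is even}.\end{cases}$$
   Context: Graphs are finite, undirected and simple, with nonnegative edge lengths $w$. For a graph $X$, $d_X(u,v)$ is the shortest-path distance with respect to $w$ (equal to $+\infty$ if $u,v$ are disconnected). A subgraph $H=(V,E')$ of $G=(V,E)$ (with inherited lengths) is an $f$-edge fault tolerant ($f$-EFT) $t$-spanner of $G$ if $d_{H\setminus F}(u,v)\le t\cdot d_{G\setminus F}(u,v)$ for all $u,v\in V$ and all $F\subseteq E$ with $|F|\le f$, where $X\setminus F$ denotes $X$ with the edges in $F$ removed. -}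

module Defs where

open import Data.Bool using (if_then_else_)
open import Data.Fin using (Fin)
import Data.Fin as Fin
open import Data.Fin.Subset using (Subset; _∈_; _─_; ⊤; ∣_∣)
open import Data.Integer using (+_)
open import Data.Nat using (ℕ; zero; suc; NonZero; _∸_)
import Data.Nat as ℕ
import Data.Nat.Properties as ℕₚ
open import Data.Nat.Divisibility using (_∣?_)
open import Data.Product using (∃; ∃₂; _×_; _,_; proj₁; proj₂)
open import Data.Rational using (ℚ; 0ℚ; 1ℚ; ½; _/_)
import Data.Rational as ℚ
import Data.Rational.Properties as ℚₚ
open import Data.Sum using (_⊎_; inj₁; inj₂)
open import Function.Definitions using (Injective)
open import Relation.Binary.PropositionalEquality
  using (_≡_; refl; sym; trans; cong; subst)
open import Relation.Nullary using (¬_; does)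

------------------------------------------------------------------------
-- Real numbers

-- Elements of [0, ∞] as (one-sided, classical) Dedekind cuts: x is given by
-- the set of all rationals q < x. The set of all rationals is the element ∞.

record ℝ≥0∞ : Set₁ where
  field
    lower    : ℚ → Set
    negative : ∀ {q} → q ℚ.< 0ℚ → lower q
    closed   : ∀ {p q} → p ℚ.< q → lower q → lower p
    rounded  : ∀ {q} → lower q → ∃ λ r → q ℚ.< r × lower r

open ℝ≥0∞ public

infix 4 _≤_ _<_

_≤_ : ℝ≥0∞ → ℝ≥0∞ → Set
x ≤ y = ∀ q → lower x q → lower y q

_<_ : ℝ≥0∞ → ℝ≥0∞ → Set
x < y = ∃ λ q → lower y q × ¬ lower x q

record ℝ≥0 : Set₁ where
  field
    value  : ℝ≥0∞
    finite : ∃ λ q → ¬ lower value q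

open ℝ≥0 public

fromℕ : ℕ → ℝ≥0∞
fromℕ n = record
  { lower    = λ q → q ℚ.< + n / 1
  ; negative = λ q<0 → ℚₚ.<-≤-trans q<0 0≤n
  ; closed   = ℚₚ.<-trans
  ; rounded  = ℚₚ.<-dense
  }
  where
  0≤n : 0ℚ ℚ.≤ + n / 1
  0≤n = ℚₚ.nonNegative⁻¹ _ {{ℚₚ.normalize-nonNeg n 1}}

infixl 6 _+_
infixl 7 _*_

_+_ : ℝ≥0∞ → ℝ≥0∞ → ℝ≥0∞
x + y = record
  { lower    = λ q → ∃₂ λ s t → lower x s × lower y t × q ≡ s ℚ.+ t
  ; negative = λ {q} q<0 →
      let h<0 = subst (q ℚ.* ½ ℚ.<_) (ℚₚ.*-zeroˡ ½) (ℚₚ.*-monoˡ-<-pos ½ q<0)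
      in q ℚ.* ½ , q ℚ.* ½ , negative x h<0 , negative y h<0 , halves q
  ; closed   = λ { {p} p<q (s , t , s∈x , t∈y , refl) →
      p ℚ.- t , t
      , closed x (subst (p ℚ.- t ℚ.<_) (cancel s t) (ℚₚ.+-monoˡ-< (ℚ.- t) p<q)) s∈x
      , t∈y , restore p t }
  ; rounded  = λ { (s , t , s∈x , t∈y , refl) →
      let s′ , s<s′ , s′∈x = rounded x s∈x
      in s′ ℚ.+ t , ℚₚ.+-monoˡ-< t s<s′ , s′ , t , s′∈x , t∈y , refl }
  }
  where
  halves : ∀ q → q ≡ q ℚ.* ½ ℚ.+ q ℚ.* ½
  halves q = trans (sym (ℚₚ.*-identityʳ q)) (ℚₚ.*-distribˡ-+ q ½ ½)

  cancel : ∀ s t → s ℚ.+ t ℚ.- t ≡ s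
  cancel s t = trans (ℚₚ.+-assoc s t (ℚ.- t))
    (trans (cong (s ℚ.+_) (ℚₚ.+-inverseʳ t)) (ℚₚ.+-identityʳ s))

  restore : ∀ p t → p ≡ p ℚ.- t ℚ.+ t
  restore p t = sym (trans (ℚₚ.+-assoc p (ℚ.- t) t)
    (trans (cong (p ℚ.+_) (ℚₚ.+-inverseˡ t)) (ℚₚ.+-identityʳ p)))

-- Here 0 * ∞ = 0.

_*_ : ℝ≥0∞ → ℝ≥0∞ → ℝ≥0∞
x * y = record
  { lower    = Lower
  ; negative = inj₁
  ; closed   = λ where
      p<q (inj₁ q<0) → inj₁ (ℚₚ.<-trans p<q q<0)
      p<q (inj₂ (s , t , 0≤s , 0≤t , s∈x , t∈y , q≤st)) →
        inj₂ (s , t , 0≤s , 0≤t , s∈x , t∈y , ℚₚ.≤-trans (ℚₚ.<⇒≤ p<q) q≤st)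
  ; rounded  = λ where
      (inj₁ q<0) → let r , q<r , r<0 = ℚₚ.<-dense q<0 in r , q<r , inj₁ r<0
      (inj₂ (s , t , 0≤s , 0≤t , s∈x , t∈y , q≤st)) →
        let s′ , s<s′ , s′∈x = rounded x s∈x
            t′ , t<t′ , t′∈y = rounded y t∈y
        in s′ ℚ.* t′
         , ℚₚ.≤-<-trans q≤st (*-mono 0≤s 0≤t s<s′ t<t′)
         , inj₂ (s′ , t′ , ℚₚ.≤-trans 0≤s (ℚₚ.<⇒≤ s<s′)
                , ℚₚ.≤-trans 0≤t (ℚₚ.<⇒≤ t<t′) , s′∈x , t′∈y , ℚₚ.≤-refl)
  }
  where
  Lower : ℚ → Set
  Lower q = q ℚ.< 0ℚ ⊎ (∃₂ λ s t →
    0ℚ ℚ.≤ s × 0ℚ ℚ.≤ t × lower x s × lower y t × q ℚ.≤ s ℚ.* t)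

  *-mono : ∀ {s s′ t t′} → 0ℚ ℚ.≤ s → 0ℚ ℚ.≤ t → s ℚ.< s′ → t ℚ.< t′ →
           s ℚ.* t ℚ.< s′ ℚ.* t′
  *-mono {s} {s′} {t} {t′} 0≤s 0≤t s<s′ t<t′ = ℚₚ.≤-<-trans
    (ℚₚ.*-monoˡ-≤-nonNeg s {{ℚ.nonNegative 0≤s}} (ℚₚ.<⇒≤ t<t′))
    (ℚₚ.*-monoˡ-<-pos t′ {{ℚ.positive (ℚₚ.≤-<-trans 0≤t t<t′)}} s<s′)

-- The infimum of the empty family is ∞. The bound q < s makes the
-- intersection of the cuts rounded again.

⨅ : {I : Set} → (I → ℝ≥0∞) → ℝ≥0∞
⨅ x = record
  { lower    = λ q → ∃ λ s → q ℚ.< s × (∀ i → lower (x i) s)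
  ; negative = λ q<0 →
      let s , q<s , s<0 = ℚₚ.<-dense q<0 in s , q<s , λ i → negative (x i) s<0
  ; closed   = λ { p<q (s , q<s , h) → s , ℚₚ.<-trans p<q q<s , h }
  ; rounded  = λ { (s , q<s , h) →
      let r , q<r , r<s = ℚₚ.<-dense q<s in r , q<r , s , r<s , h }
  }

_^_ : ℚ → ℕ → ℚ
s ^ zero  = 1ℚ
s ^ suc q = s ℚ.* (s ^ q)

-- a ^[ p / q ] is the real number a^(p/q), as the supremum of all rationals
-- s ≥ 0 with s^q ≤ a^p.

_^[_/_] : ℕ → ℕ → (q : ℕ) → .{{NonZero q}} → ℝ≥0∞
a ^[ p / suc q ] = record
  { lower    = λ r → ∃ λ s → 0ℚ ℚ.≤ s × s ^ suc q ℚ.≤ + (a ℕ.^ p) / 1 × r ℚ.< s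
  ; negative = λ r<0 → 0ℚ , ℚₚ.≤-refl , 0^q≤ , r<0
  ; closed   = λ { p<r (s , 0≤s , s^q≤ , r<s) → s , 0≤s , s^q≤ , ℚₚ.<-trans p<r r<s }
  ; rounded  = λ { (s , 0≤s , s^q≤ , r<s) →
      let r′ , r<r′ , r′<s = ℚₚ.<-dense r<s in r′ , r<r′ , s , 0≤s , s^q≤ , r′<s }
  }
  where
  0^q≤ : 0ℚ ^ suc q ℚ.≤ + (a ℕ.^ p) / 1
  0^q≤ = subst (ℚ._≤ + (a ℕ.^ p) / 1) (sym (ℚₚ.*-zeroˡ (0ℚ ^ q)))
    (ℚₚ.nonNegative⁻¹ _ {{ℚₚ.normalize-nonNeg (a ℕ.^ p) 1}})

------------------------------------------------------------------------
-- Graphs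

-- A simple graph on the vertex set Fin n with edge set Fin size. The edge
-- {u, v} with u < v has the pair (u , v) as its ends: there are no loops, and
-- injectivity excludes parallel edges. Sets of edges, and subgraphs containing
-- all vertices, are elements of Subset size.

record Graph (n : ℕ) : Set where
  field
    size      : ℕ
    ends      : Fin size → Fin n × Fin n
    ordered   : ∀ e → proj₁ (ends e) Fin.< proj₂ (ends e)
    injective : Injective _≡_ _≡_ ends

open Graph public

module _ {n : ℕ} (G : Graph n) where

  Joins : Fin (size G) → Fin n → Fin n → Set
  Joins e u v = ends G e ≡ (u , v) ⊎ ends G e ≡ (v , u)

  data Walk (S : Subset (size G)) : Fin n → Fin n → Set where
    []   : ∀ {u} → Walk S u u
    step : ∀ {u v t} e → e ∈ S → Joins e u v → Walk S v t → Walk S u t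

  module _ (w : Fin (size G) → ℝ≥0) where

    length : ∀ {S u v} → Walk S u v → ℝ≥0∞
    length []             = fromℕ 0
    length (step e _ _ π) = value (w e) + length π

    -- Distance in the subgraph with edge set S. Lengths are nonnegative, so
    -- repeated vertices never make a walk shorter.

    dist : Subset (size G) → Fin n → Fin n → ℝ≥0∞
    dist S u v = ⨅ (length {S} {u} {v})

    IsEFTSpanner : (f : ℕ) (t : ℝ≥0∞) → Subset (size G) → Set
    IsEFTSpanner f t H = ∀ (F : Subset (size G)) → ∣ F ∣ ℕ.≤ f →
      ∀ u v → dist (H ─ F) u v ≤ t * dist (⊤ ─ F) u v

------------------------------------------------------------------------
-- The size bound

-- 1 + 1/k = (k + 1)/k and 1/2 - 1/(2k) = (k - 1)/(2k).

sizeBound : (C : ℝ≥0) (n f k : ℕ) → .{{NonZero k}} → ℝ≥0∞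
sizeBound C n f k =
  if does (2 ∣? k)
  then value C * (fromℕ (k ℕ.^ 2) * f ^[ 1 / 2 ] * n ^[ k ℕ.+ 1 / k ]
                  + fromℕ (k ℕ.* f ℕ.* n))
  else value C * (fromℕ (k ℕ.^ 2) * f ^[ k ∸ 1 / 2 ℕ.* k ] * n ^[ k ℕ.+ 1 / k ]
                  + fromℕ (k ℕ.* f ℕ.* n))
  where instance
  2k≢0 : NonZero (2 ℕ.* k)
  2k≢0 = ℕₚ.m*n≢0 2 k

{-# OPTIONS --safe #-}

-- The spanner H is greedy: an edge e enters H if, for some set F e of at most f
-- edges, the lighter part of H outside F e has no detour of at most 2k - 1 edges.
-- Hence every walk of at most 2k - 1 lighter edges of H closing e meets F e.
--
-- To bound |H|, count trails of k edges with e₁ < e₂ > e₃ < …, no edge of which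
-- lies in the F-set of another one. If π and π′ are two such trails between the
-- same ends and e is the heaviest edge of both, lying in π say, then π ∪ π′ - e
-- is a detour of e, so π′ contains e or an edge of F e. After discarding
-- the edges that lie in too many F-sets, each edge x of π′ determines O(f)
-- candidates e. As e has even position in π, it splits π into an odd part and a
-- rest, and induction gives at most (O(k² f))^⌊k/2⌋ trails between two vertices.
--
-- Conversely, deleting the lightest or heaviest edge at every vertex, k times over,
-- produces an alternating trail in every set of more than kn edges. Applied to a
-- random sample of the edges with probability 1/c for a suitable c ≈ |H|/(kn), as
-- in the proof of the crossing lemma, this yields about n (|H|/(kn))^k trails.

module Submission where

-- The parity in the bound comes from rounding. Splitting a trail of `k` edges at its heaviest edge
-- into parts of `a` and `b` edges costs a factor O(k² f), so the induction closes only if ⌊a/2⌋ +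
-- ⌊b/2⌋ = ⌊k/2⌋ - 1. This fails when `a` and `b` are both even, and alternation is what forces `a`
-- to be odd. Let `U` be the set of edges kept after the discarding, and A the number of trails in
-- it. Sampling at density 1/c gives |U|/c ≤ A/c^k + |U| f/c² + (k - 1) n. The choice c ≈ |U|/(4kn)
-- keeps the last term small, but it controls the middle term only if c ≥ 4f; the remaining case |U|
-- = O(kfn) is the second summand of the theorem. With A ≤ n² Q^⌊k/2⌋ and Q = O(k² f) this leaves
-- c^k ≤ n Q^⌊k/2⌋, so |H| is O(kn) times the k-th root of n Q^⌊k/2⌋. The factor k² is the product
-- of this k and of (k²)^(⌊k/2⌋/k) ≤ k; the exponent ⌊k/2⌋/k of f is 1/2 or 1/2 - 1/(2k).

module Summation where

  open import Axiom.ExcludedMiddle using (ExcludedMiddle)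
  open import Data.Bool using (true; false; if_then_else_)
  open import Data.Empty using (⊥-elim)
  open import Data.Fin using (Fin; zero; suc)
  open import Data.Fin.Subset using (Subset; ∣_∣) renaming (_∈_ to _∈ₛ_)
  open import Data.Fin.Subset.Properties using (drop-there)
  open import Data.List
    using (List; []; _∷_; _++_; map; length; allFin; replicate; cartesianProductWith)
  open import Data.List.Membership.Propositional using (_∈_)
  open import Data.List.Membership.Propositional.Properties using (∈-allFin)
  open import Data.List.Properties using (map-tabulate)
  open import Data.List.Relation.Unary.All using (All; []; _∷_)
  open import Data.List.Relation.Unary.AllPairs using ([]; _∷_)
  open import Data.List.Relation.Unary.Any using (here; there)
  open import Data.List.Relation.Unary.Unique.Propositional using (Unique)
  open import Data.List.Relation.Unary.Unique.Propositional.Properties using (allFin⁺)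
  import Data.List.Relation.Unary.All as All
  open import Data.Nat using (ℕ; zero; suc; _+_; _*_; _≤_; _<_; z≤n)
  open import Data.Nat.ListAction using (sum)
  open import Data.Nat.Properties
  open import Data.Nat.Solver using (module +-*-Solver)
  open import Data.Product using (_×_; _,_)
  open import Data.Vec using (_∷_; []; here; there)
  import Data.Vec as Vec
  open import Data.Vec.Properties using (lookup∘tabulate; []=⇒lookup; lookup⇒[]=)
  open import Function using (_∘_)
  open import Level using (0ℓ)
  open import Relation.Binary.PropositionalEquality
  open import Relation.Nullary using (¬_; yes; no; does)

  private variable
    A B : Set

  -- Finite sums over lists

  ∑ : List A → (A → ℕ) → ℕ
  ∑ xs f = sum (map f xs)

  ∑-mono-∈ : ∀ (xs : List A) {f g} → (∀ {x} → x ∈ xs → f x ≤ g x) → ∑ xs f ≤ ∑ xs g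
  ∑-mono-∈ []       h = z≤n
  ∑-mono-∈ (x ∷ xs) h = +-mono-≤ (h (here refl)) (∑-mono-∈ xs (h ∘ there))

  ∑-mono : ∀ (xs : List A) {f g} → (∀ x → f x ≤ g x) → ∑ xs f ≤ ∑ xs g
  ∑-mono xs h = ∑-mono-∈ xs (λ _ → h _)

  ∑-mono-< : ∀ (xs : List A) {f g} {y} → (∀ x → f x ≤ g x) → y ∈ xs → f y < g y → ∑ xs f < ∑ xs g
  ∑-mono-< (x ∷ xs) h (here refl) lt = +-mono-<-≤ lt (∑-mono xs h)
  ∑-mono-< (x ∷ xs) h (there y∈)  lt = +-mono-≤-< (h x) (∑-mono-< xs h y∈ lt)

  ∑-cong : ∀ (xs : List A) {f g} → (∀ x → f x ≡ g x) → ∑ xs f ≡ ∑ xs g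
  ∑-cong []       h = refl
  ∑-cong (x ∷ xs) h = cong₂ _+_ (h x) (∑-cong xs h)

  ∑-++ : ∀ (xs ys : List A) f → ∑ (xs ++ ys) f ≡ ∑ xs f + ∑ ys f
  ∑-++ []       ys f = refl
  ∑-++ (x ∷ xs) ys f = trans (cong (f x +_) (∑-++ xs ys f)) (sym (+-assoc (f x) _ _))

  ∑-map : ∀ (h : A → B) xs f → ∑ (map h xs) f ≡ ∑ xs (f ∘ h)
  ∑-map h []       f = refl
  ∑-map h (x ∷ xs) f = cong (f (h x) +_) (∑-map h xs f)

  ∑-+ : ∀ (xs : List A) f g → ∑ xs (λ x → f x + g x) ≡ ∑ xs f + ∑ xs g
  ∑-+ []       f g = refl
  ∑-+ (x ∷ xs) f g = trans (cong (f x + g x +_) (∑-+ xs f g))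
    (solve 4 (λ a b c d → (a :+ b) :+ (c :+ d) := (a :+ c) :+ (b :+ d)) refl (f x) (g x) _ _)
    where open +-*-Solver

  ∑-*ˡ : ∀ (xs : List A) c f → ∑ xs (λ x → c * f x) ≡ c * ∑ xs f
  ∑-*ˡ []       c f = sym (*-zeroʳ c)
  ∑-*ˡ (x ∷ xs) c f = trans (cong (c * f x +_) (∑-*ˡ xs c f)) (sym (*-distribˡ-+ c (f x) _))

  ∑-*ʳ : ∀ (xs : List A) f c → ∑ xs (λ x → f x * c) ≡ ∑ xs f * c
  ∑-*ʳ []       f c = refl
  ∑-*ʳ (x ∷ xs) f c = trans (cong (f x * c +_) (∑-*ʳ xs f c)) (sym (*-distribʳ-+ c (f x) _))

  ∑-const : ∀ (xs : List A) c → ∑ xs (λ _ → c) ≡ length xs * c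
  ∑-const []       c = refl
  ∑-const (x ∷ xs) c = cong (c +_) (∑-const xs c)

  ∑-swap : ∀ (xs : List A) (ys : List B) (f : A → B → ℕ) →
    ∑ xs (λ x → ∑ ys (f x)) ≡ ∑ ys (λ y → ∑ xs (λ x → f x y))
  ∑-swap []       ys f = sym (trans (∑-const ys 0) (*-zeroʳ (length ys)))
  ∑-swap (x ∷ xs) ys f = trans (cong (∑ ys (f x) +_) (∑-swap xs ys f)) (sym (∑-+ ys (f x) _))

  ∑-∈ : ∀ {xs : List A} {x} f → x ∈ xs → f x ≤ ∑ xs f
  ∑-∈ f (here refl)          = m≤m+n _ _
  ∑-∈ {xs = y ∷ _} f (there p) = ≤-trans (∑-∈ f p) (m≤n+m _ (f y))

  ∑-prod : ∀ {C : Set} (h : A → B → C) xs ys f →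
    ∑ (cartesianProductWith h xs ys) f ≡ ∑ xs (λ x → ∑ ys (λ y → f (h x y)))
  ∑-prod h []       ys f = refl
  ∑-prod h (x ∷ xs) ys f = trans (∑-++ (map (h x) ys) _ f)
    (cong₂ _+_ (∑-map (h x) ys f) (∑-prod h xs ys f))

  ∑-replicate : ∀ d (x : A) f → ∑ (replicate d x) f ≡ d * f x
  ∑-replicate zero    x f = refl
  ∑-replicate (suc d) x f = cong (f x +_) (∑-replicate d x f)

  ∑-allFin-suc : ∀ m f → ∑ (allFin (suc m)) f ≡ f zero + ∑ (allFin m) (f ∘ suc)
  ∑-allFin-suc m f = cong (f zero +_)
    (trans (cong (λ xs → ∑ xs f) (sym (map-tabulate (λ x → x) suc))) (∑-map suc (allFin m) f))

  -- Counting by indicators of arbitrary propositions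

  module Indicator (em : ExcludedMiddle 0ℓ) where

    ι : Set → ℕ
    ι P = if does (em {P}) then 1 else 0

    ι-elim : ∀ {P : Set} {c} → (P → 1 ≤ c) → ι P ≤ c
    ι-elim {P} h with em {P}
    ... | yes p = h p
    ... | no  _ = z≤n

    ι-yes : ∀ {P : Set} → P → ι P ≡ 1
    ι-yes {P} p with em {P}
    ... | yes _ = refl
    ... | no ¬p = ⊥-elim (¬p p)

    ι-no : ∀ {P : Set} → ¬ P → ι P ≡ 0
    ι-no {P} ¬p with em {P}
    ... | yes p = ⊥-elim (¬p p)
    ... | no _  = refl

    ι≤1 : ∀ {P : Set} → ι P ≤ 1
    ι≤1 = ι-elim (λ _ → ≤-refl)

    1≤ι : ∀ {P : Set} → P → 1 ≤ ι P
    1≤ι p = ≤-reflexive (sym (ι-yes p))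

    ι-mono : ∀ {P Q : Set} → (P → Q) → ι P ≤ ι Q
    ι-mono h = ι-elim (1≤ι ∘ h)

    ι-× : ∀ {P Q : Set} → ι (P × Q) ≤ ι P * ι Q
    ι-× = ι-elim λ { (p , q) → ≤-reflexive (sym (cong₂ _*_ (ι-yes p) (ι-yes q))) }

    ι-*-mono : ∀ {P : Set} {a b} → (P → a ≤ b) → ι P * a ≤ ι P * b
    ι-*-mono {P} h with em {P}
    ... | yes p = *-monoʳ-≤ 1 (h p)
    ... | no _  = z≤n

    -- The indicators are distributed crosswise for double counting over pairs: `a` keeps only the
    -- indicator of `Q`, so that it can be summed freely over the object that `P` speaks of, and `b`
    -- conversely.
    ι-*-ι-mono : ∀ {P Q : Set} {a b} → (P → Q → 1 ≤ a + b) → ι P * ι Q ≤ ι Q * a + ι P * b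
    ι-*-ι-mono {P} {Q} {a} {b} h with em {P} | em {Q}
    ... | yes p | yes q = ≤-trans (h p q) (≤-reflexive (sym (cong₂ _+_ (*-identityˡ a) (*-identityˡ b))))
    ... | yes _ | no  _ = z≤n
    ... | no  _ | _     = z≤n

    ∑-none : ∀ {A : Set} (xs : List A) (P : A → Set) → (∀ {x} → x ∈ xs → ¬ P x) → ∑ xs (ι ∘ P) ≡ 0
    ∑-none []       P h = refl
    ∑-none (x ∷ xs) P h = cong₂ _+_ (ι-no (h (here refl))) (∑-none xs P (h ∘ there))

    ∑-atMostOne : ∀ {A : Set} {xs : List A} (P : A → Set) → Unique xs →
      (∀ {x y} → P x → P y → x ≡ y) → ∑ xs (ι ∘ P) ≤ 1
    ∑-atMostOne P [] h = z≤n
    ∑-atMostOne {xs = x ∷ xs} P (x∉ ∷ u) h with em {P x}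
    ... | yes p = ≤-reflexive (cong suc (∑-none xs P λ y∈ q → All.lookup x∉ y∈ (h p q)))
    ... | no _  = ∑-atMostOne P u h

    ∑-single : ∀ {m} (y : Fin m) (g : Fin m → ℕ) → ∑ (allFin m) (λ x → ι (x ≡ y) * g x) ≤ g y
    ∑-single {m} y g = begin
      ∑ (allFin m) (λ x → ι (x ≡ y) * g x) ≤⟨ ∑-mono (allFin m) (λ x → ι-*-mono {a = g x} {g y} λ { refl
            → ≤-refl }) ⟩
      ∑ (allFin m) (λ x → ι (x ≡ y) * g y) ≡⟨ ∑-*ʳ (allFin m) _ (g y) ⟩
      ∑ (allFin m) (λ x → ι (x ≡ y)) * g y ≤⟨ *-monoˡ-≤ (g y) (∑-atMostOne (_≡ y) (allFin⁺ m) λ { refl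
            refl → refl }) ⟩
      1 * g y                              ≡⟨ *-identityˡ (g y) ⟩
      g y                                  ∎
      where open ≤-Reasoning

    ∣_∣≡∑ : ∀ {m} (S : Subset m) → ∣ S ∣ ≡ ∑ (allFin m) (λ e → ι (e ∈ₛ S))
    ∣ [] ∣≡∑ = refl
    ∣_∣≡∑ {suc m} (b ∷ S) = sym (begin
      ∑ (allFin (suc m)) (λ e → ι (e ∈ₛ b ∷ S))
        ≡⟨ ∑-allFin-suc m (λ e → ι (e ∈ₛ b ∷ S)) ⟩
      ι (zero ∈ₛ b ∷ S) + ∑ (allFin m) (λ e → ι (suc e ∈ₛ b ∷ S))
        ≡⟨ cong (ι (zero ∈ₛ b ∷ S) +_) (∑-cong (allFin m) λ e → ≤-antisym (ι-mono drop-there) (ι-mono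
              there)) ⟩
      ι (zero ∈ₛ b ∷ S) + ∑ (allFin m) (λ e → ι (e ∈ₛ S))
        ≡⟨ cong (ι (zero ∈ₛ b ∷ S) +_) (sym ∣ S ∣≡∑) ⟩
      ι (zero ∈ₛ b ∷ S) + ∣ S ∣
        ≡⟨ head b ⟩
      ∣ b ∷ S ∣ ∎)
      where
      open ≡-Reasoning
      head : ∀ b → ι (zero ∈ₛ b ∷ S) + ∣ S ∣ ≡ ∣ b ∷ S ∣
      head true  = cong (_+ ∣ S ∣) (ι-yes here)
      head false = cong (_+ ∣ S ∣) (ι-no λ ())

    ⟪_⟫ : ∀ {m} → (Fin m → Set) → Subset m
    ⟪ P ⟫ = Vec.tabulate (λ e → does (em {P e}))

    ∈⟪⟫⁺ : ∀ {m} {P : Fin m → Set} {e} → P e → e ∈ₛ ⟪ P ⟫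
    ∈⟪⟫⁺ {P = P} {e} p = lookup⇒[]= e _ (trans (lookup∘tabulate _ e) eq)
      where
      eq : does (em {P e}) ≡ true
      eq with em {P e}
      ... | yes _ = refl
      ... | no ¬p = ⊥-elim (¬p p)

    ∈⟪⟫⁻ : ∀ {m} {P : Fin m → Set} {e} → e ∈ₛ ⟪ P ⟫ → P e
    ∈⟪⟫⁻ {P = P} {e} e∈ = from (trans (sym (lookup∘tabulate _ e)) ([]=⇒lookup e∈))
      where
      from : does (em {P e}) ≡ true → P e
      from eq with em {P e}
      ... | yes p = p

    length≤∑∈ : ∀ {m} (τ : List (Fin m)) → Unique τ → length τ ≤ ∑ (allFin m) (λ e → ι (e ∈ τ))
    length≤∑∈ []      _ = z≤n
    length≤∑∈ {m} (x ∷ τ) (x∉ ∷ u) = begin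
      suc (length τ)
        ≤⟨ +-mono-≤ (≤-trans (1≤ι refl) (∑-∈ (λ e → ι (e ≡ x)) (∈-allFin x))) (length≤∑∈ τ u) ⟩
      ∑ (allFin m) (λ e → ι (e ≡ x)) + ∑ (allFin m) (λ e → ι (e ∈ τ))
        ≡⟨ ∑-+ (allFin m) (λ e → ι (e ≡ x)) (λ e → ι (e ∈ τ)) ⟨
      ∑ (allFin m) (λ e → ι (e ≡ x) + ι (e ∈ τ))
        ≤⟨ ∑-mono (allFin m) disjoint ⟩
      ∑ (allFin m) (λ e → ι (e ∈ x ∷ τ)) ∎
      where
      open ≤-Reasoning
      disjoint : ∀ e → ι (e ≡ x) + ι (e ∈ τ) ≤ ι (e ∈ x ∷ τ)
      disjoint e with em {e ≡ x}
      ... | yes refl = ≤-trans (≤-reflexive (cong suc (ι-no λ e∈ → All.lookup x∉ e∈ refl))) (1≤ι (here refl))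
      ... | no _     = ι-mono there

    ∑∈≤length : ∀ {m} (τ : List (Fin m)) → ∑ (allFin m) (λ e → ι (e ∈ τ)) ≤ length τ
    ∑∈≤length {m} [] = ≤-reflexive (∑-none (allFin m) _ λ _ ())
    ∑∈≤length {m} (x ∷ τ) = begin
      ∑ (allFin m) (λ e → ι (e ∈ x ∷ τ))
        ≤⟨ ∑-mono (allFin m) (λ e → ι-elim λ { (here refl) → ≤-trans (1≤ι refl) (m≤m+n _ _)
                                             ; (there e∈) → ≤-trans (1≤ι e∈) (m≤n+m _ (ι (e ≡ x))) }) ⟩
      ∑ (allFin m) (λ e → ι (e ≡ x) + ι (e ∈ τ))
        ≡⟨ ∑-+ (allFin m) (λ e → ι (e ≡ x)) (λ e → ι (e ∈ τ)) ⟩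
      ∑ (allFin m) (λ e → ι (e ≡ x)) + ∑ (allFin m) (λ e → ι (e ∈ τ))
        ≤⟨ +-mono-≤ (∑-atMostOne (_≡ x) (allFin⁺ m) λ { refl refl → refl }) (∑∈≤length τ) ⟩
      suc (length τ) ∎
      where open ≤-Reasoning

-- Upper bound on the number of alternating trails between two vertices

module TrailCounting where

  open import Axiom.ExcludedMiddle using (ExcludedMiddle)
  open import Data.Bool using (Bool; true; false; not)
  open import Data.Empty using (⊥; ⊥-elim)
  open import Data.Fin using (Fin)
  import Data.Fin as Fin
  import Data.Fin.Properties as Fin
  open import Data.Fin.Subset using (Subset) renaming (_∈_ to _∈ₛ_; _∉_ to _∉ₛ_)
  open import Data.List
    using (List; []; _∷_; _++_; length; allFin; reverse; upTo; cartesianProductWith)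
  open import Data.List.Membership.Propositional using (_∈_; find)
  open import Data.List.Membership.Propositional.Properties
    using (∈-allFin; ∈-cartesianProductWith⁺; ∈-cartesianProductWith⁻; ∈-upTo⁺; ∈-upTo⁻)
  open import Data.List.Properties
    using (unfold-reverse; length-reverse; length-++; ∷-injective; length-upTo)
  open import Data.List.Relation.Unary.All using (All; []; _∷_)
  import Data.List.Relation.Unary.All as All
  import Data.List.Relation.Unary.All.Properties as All
  open import Data.List.Relation.Unary.AllPairs using (AllPairs; []; _∷_)
  open import Data.List.Relation.Unary.Any using (Any; here)
  import Data.List.Relation.Unary.Any.Properties as Any
  open import Data.List.Relation.Unary.Unique.Propositional.Properties using (allFin⁺)
  open import Data.Nat
    using (ℕ; zero; suc; _+_; _*_; _^_; _≤_; _<_; z≤n; s≤s; ⌊_/2⌋; NonZero; >-nonZero⁻¹)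
  open import Data.Nat.Induction using (<-rec)
  open import Data.Nat.Properties
  open import Data.Nat.Solver using (module +-*-Solver)
  open import Data.Product using (∃; ∃₂; _×_; _,_; proj₁; proj₂)
  open import Data.Sum using (_⊎_; inj₁; inj₂; swap)
  open import Data.Unit using (⊤; tt)
  open import Function using (_∘_)
  open import Level using (0ℓ)
  open import Relation.Binary.PropositionalEquality
  open import Relation.Nullary using (Dec; yes; no)
  open import Defs using (Graph; size; ends; ordered; injective; Joins)

  open Summation

  Odd : ℕ → Set
  Odd 0             = ⊥
  Odd 1             = ⊤
  Odd (suc (suc a)) = Odd a

  -- The edge between the two parts completes the odd part to an even length, so only the rounding
  -- of `b` remains.
  ⌊odd+suc/2⌋ : ∀ a b → Odd a → ⌊ a + suc b /2⌋ ≡ suc (⌊ a /2⌋ + ⌊ b /2⌋)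
  ⌊odd+suc/2⌋ 1             b _ = refl
  ⌊odd+suc/2⌋ (suc (suc a)) b o = cong suc (⌊odd+suc/2⌋ a b o)

  ++-injective : ∀ {A : Set} (α α′ : List A) {β β′} →
    length α ≡ length α′ → α ++ β ≡ α′ ++ β′ → α ≡ α′ × β ≡ β′
  ++-injective []      []        _  eq = refl , eq
  ++-injective (x ∷ α) (x′ ∷ α′) l≡ eq =
    let x≡ , eq′ = ∷-injective eq
        α≡ , β≡  = ++-injective α α′ (suc-injective l≡) eq′
    in cong₂ _∷_ x≡ α≡ , β≡

  allPairs-++⁻ : ∀ {A : Set} {R : A → A → Set} α {β} →
    AllPairs R (α ++ β) → AllPairs R α × AllPairs R β × All (λ x → All (R x) β) α
  allPairs-++⁻ []      p       = [] , p , []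
  allPairs-++⁻ (x ∷ α) (q ∷ p) =
    let pα , pβ , pαβ = allPairs-++⁻ α p
    in All.++⁻ˡ α q ∷ pα , pβ , All.++⁻ʳ α q ∷ pαβ

  seqs : ∀ m → ℕ → List (List (Fin m))
  seqs m zero    = [] ∷ []
  seqs m (suc k) = cartesianProductWith _∷_ (allFin m) (seqs m k)

  ∈seqs⁺ : ∀ {m} (τ : List (Fin m)) → τ ∈ seqs m (length τ)
  ∈seqs⁺ []      = here refl
  ∈seqs⁺ (e ∷ τ) = ∈-cartesianProductWith⁺ _∷_ (∈-allFin e) (∈seqs⁺ τ)

  ∈seqs⁻ : ∀ {m} k {τ : List (Fin m)} → τ ∈ seqs m k → length τ ≡ k
  ∈seqs⁻ zero    (here refl) = refl
  ∈seqs⁻ {m} (suc k) τ∈ with _ , _ , _ , τ′∈ , refl ← ∈-cartesianProductWith⁻ _∷_ (allFin m) (seqs m k) τ∈ =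
    cong suc (∈seqs⁻ k τ′∈)

  ∑-seqs-++ : ∀ m a b (f : List (Fin m) → ℕ) →
    ∑ (seqs m (a + b)) f ≡ ∑ (seqs m a) (λ α → ∑ (seqs m b) (λ β → f (α ++ β)))
  ∑-seqs-++ m zero    b f = sym (+-identityʳ _)
  ∑-seqs-++ m (suc a) b f = begin
    ∑ (seqs m (suc a + b)) f
      ≡⟨ ∑-prod _∷_ (allFin m) (seqs m (a + b)) f ⟩
    ∑ (allFin m) (λ e → ∑ (seqs m (a + b)) (λ τ → f (e ∷ τ)))
      ≡⟨ ∑-cong (allFin m) (λ e → ∑-seqs-++ m a b (λ τ → f (e ∷ τ))) ⟩
    ∑ (allFin m) (λ e → ∑ (seqs m a) (λ α → ∑ (seqs m b) (λ β → f (e ∷ α ++ β))))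
      ≡⟨ ∑-prod _∷_ (allFin m) (seqs m a) _ ⟨
    ∑ (seqs m (suc a)) (λ α → ∑ (seqs m b) (λ β → f (α ++ β))) ∎
    where open ≡-Reasoning

  module Walks {n} (G : Graph n) where

    E : Set
    E = Fin (size G)

    -- In contrast to `Walk`, the edges form a plain list, which can be enumerated by `seqs`, cut,
    -- reversed and concatenated.
    Run : Fin n → List E → Fin n → Set
    Run s []      t = s ≡ t
    Run s (e ∷ τ) t = ∃ λ v → Joins G e s v × Run v τ t

    run-++⁺ : ∀ {s u t} α {β} → Run s α u → Run u β t → Run s (α ++ β) t
    run-++⁺ []      refl        q = q
    run-++⁺ (e ∷ α) (v , j , p) q = v , j , run-++⁺ α p q

    run-++⁻ : ∀ {s t} α {β} → Run s (α ++ β) t → ∃ λ u → Run s α u × Run u β t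
    run-++⁻ []      p           = _ , refl , p
    run-++⁻ (e ∷ α) (v , j , p) = let u , p₁ , p₂ = run-++⁻ α p in u , (v , j , p₁) , p₂

    run-reverse : ∀ {s t} τ → Run s τ t → Run t (reverse τ) s
    run-reverse []      refl        = refl
    run-reverse {s} (e ∷ τ) (v , j , p) =
      subst (λ τ′ → Run _ τ′ s) (sym (unfold-reverse e τ))
        (run-++⁺ (reverse τ) (run-reverse τ p) (s , swap j , refl))

    joins-unique : ∀ {e e′ u v} → Joins G e u v → Joins G e′ u v → e ≡ e′
    joins-unique (inj₁ p) (inj₁ q) = injective G (trans p (sym q))
    joins-unique (inj₂ p) (inj₂ q) = injective G (trans p (sym q))
    joins-unique {e} {e′} (inj₁ p) (inj₂ q) = ⊥-elim (Fin.<-asym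
      (subst (λ (x , y) → x Fin.< y) p (ordered G e)) (subst (λ (x , y) → x Fin.< y) q (ordered G e′)))
    joins-unique {e} {e′} (inj₂ p) (inj₁ q) = ⊥-elim (Fin.<-asym
      (subst (λ (x , y) → x Fin.< y) p (ordered G e)) (subst (λ (x , y) → x Fin.< y) q (ordered G e′)))

  module Trails {n} (G : Graph n) (r : Fin (size G) → ℕ) (F : Fin (size G) → Subset (size G))
    (U : Subset (size G)) where

    open Walks G

    _≺[_]_ : E → Bool → E → Set
    e ≺[ true  ] e′ = r e < r e′
    e ≺[ false ] e′ = r e′ < r e

    Alt : Bool → List E → Set
    Alt b []           = ⊤
    Alt b (_ ∷ [])     = ⊤
    Alt b (e ∷ e′ ∷ τ) = e ≺[ b ] e′ × Alt (not b) (e′ ∷ τ)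

    alt-++⁻ˡ : ∀ b α {β} → Alt b (α ++ β) → Alt b α
    alt-++⁻ˡ b []           _       = tt
    alt-++⁻ˡ b (_ ∷ [])     _       = tt
    alt-++⁻ˡ b (_ ∷ e′ ∷ α) (p , q) = p , alt-++⁻ˡ (not b) (e′ ∷ α) q

    -- In e₁ < e₂ > e₃ < ... every edge at an odd position is below a neighbour at an even one, so
    -- the maximum is attained at an even position and the prefix before it is odd. The rest after
    -- it starts at an odd position, hence again with a rise. The induction removes two edges at a
    -- time, which preserves both parities.
    heaviest : ∀ τ → Alt true τ → 2 ≤ length τ → ∃ λ α → ∃₂ λ e β →
      τ ≡ α ++ e ∷ β × Odd (length α) × Alt true α × Alt true β × All (λ x → r x ≤ r e) τ
    heaviest (e₁ ∷ [])      _ (s≤s ())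
    heaviest (e₁ ∷ e₂ ∷ []) (p , _) _ =
      e₁ ∷ [] , e₂ , [] , refl , tt , tt , tt , <⇒≤ p ∷ ≤-refl ∷ []
    heaviest (e₁ ∷ e₂ ∷ e₃ ∷ []) (p , q , _) _ =
      e₁ ∷ [] , e₂ , e₃ ∷ [] , refl , tt , tt , tt , <⇒≤ p ∷ ≤-refl ∷ <⇒≤ q ∷ []
    heaviest (e₁ ∷ e₂ ∷ τ@(e₃ ∷ _ ∷ _)) (p , q , a) _
      with α , e , β , eq , o , altα , altβ , top ← heaviest τ a (s≤s (s≤s z≤n))
      with ≤-total (r e) (r e₂)
    ... | inj₁ e≤ = e₁ ∷ [] , e₂ , τ , refl , tt , tt , a
                  , <⇒≤ p ∷ ≤-refl ∷ All.map (λ x≤ → ≤-trans x≤ e≤) top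
    ... | inj₂ ≤e = e₁ ∷ e₂ ∷ α , e , β , cong (λ τ → e₁ ∷ e₂ ∷ τ) eq , o
                  , alt-++⁻ˡ true (e₁ ∷ e₂ ∷ α) (subst (λ τ → Alt true (e₁ ∷ e₂ ∷ τ)) eq (p , q , a))
                  , altβ , ≤-trans (<⇒≤ p) ≤e ∷ ≤e ∷ top

    Apart : E → E → Set
    Apart e x = e ≢ x × x ∉ₛ F e × e ∉ₛ F x

    record Good (s : Fin n) (τ : List E) (t : Fin n) : Set where
      constructor good
      field
        run   : Run s τ t
        alt   : Alt true τ
        apart : AllPairs Apart τ
        inU   : All (_∈ₛ U) τ

    open Good public

    module Count (em : ExcludedMiddle 0ℓ) where

      open Indicator em

      private m = size G

      count : ℕ → Fin n → Fin n → ℕ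
      count k s t = ∑ (seqs m k) (λ τ → ι (Good s τ t))

      -- Only the two parts are required to be good, not `π` itself, so that they can be chosen
      -- independently. The disjunction is over the direction in which `π` traverses `e`.
      Splits : Fin n → Fin n → E → ℕ → List E → Set
      Splits s t e a π = ∃₂ λ α β → π ≡ α ++ e ∷ β × length α ≡ a × Odd a ×
        (let u , v = ends G e in (Good s α u × Good v β t) ⊎ (Good s α v × Good u β t))

      -- With `e` and its offset fixed, `π` is determined by its two parts; the factor 2 counts the
      -- directions of `e`.
      splits-bound : ∀ a b {A B} → (∀ s t → count a s t ≤ A) → (∀ s t → count b s t ≤ B) →
        ∀ s t e → ∑ (seqs m (a + suc b)) (λ π → ι (Splits s t e a π)) ≤ 2 * (A * B)
      splits-bound a b {A} {B} boundA boundB s t e = begin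
        ∑ (seqs m (a + suc b)) (λ π → ι (Splits s t e a π))
          ≡⟨ ∑-seqs-++ m a (suc b) _ ⟩
        ∑ (seqs m a) (λ α → ∑ (seqs m (suc b)) (λ β → ι (Splits s t e a (α ++ β))))
          ≤⟨ ∑-mono-∈ (seqs m a) middle ⟩
        ∑ (seqs m a) (λ α → ∑ (seqs m b) (λ β → X α β))
          ≡⟨ ∑-cong (seqs m a) (λ α → trans (∑-+ (seqs m b) _ _)
               (cong₂ _+_ (∑-*ˡ (seqs m b) (ι (Good s α u)) _) (∑-*ˡ (seqs m b) (ι (Good s α v)) _))) ⟩
        ∑ (seqs m a) (λ α → ι (Good s α u) * count b v t + ι (Good s α v) * count b u t)
          ≡⟨ trans (∑-+ (seqs m a) _ _) (cong₂ _+_ (∑-*ʳ (seqs m a) _ (count b v t)) (∑-*ʳ (seqs m a) _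
                (count b u t))) ⟩
        count a s u * count b v t + count a s v * count b u t
          ≤⟨ +-mono-≤ (*-mono-≤ (boundA s u) (boundB v t)) (*-mono-≤ (boundA s v) (boundB u t)) ⟩
        A * B + A * B
          ≡⟨ cong (A * B +_) (+-identityʳ (A * B)) ⟨
        2 * (A * B) ∎
        where
        open ≤-Reasoning
        u v : Fin n
        u = proj₁ (ends G e)
        v = proj₂ (ends G e)

        X : List E → List E → ℕ
        X α β = ι (Good s α u) * ι (Good v β t) + ι (Good s α v) * ι (Good u β t)

        case : ∀ {α e′ β} → length α ≡ a →
          ι (Splits s t e a (α ++ e′ ∷ β)) ≤ ι (e′ ≡ e) * X α β
        case {α} {e′} {β} len = ι-elim split
          where
          split : Splits s t e a (α ++ e′ ∷ β) → 1 ≤ ι (e′ ≡ e) * X α β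
          split (α′ , β′ , eq , len′ , _ , g)
            with refl , eq′ ← ++-injective α α′ (trans len (sym len′)) eq
            with refl , refl ← ∷-injective eq′ = *-mono-≤ (1≤ι refl) (halves g)
            where
            halves : (Good s α u × Good v β t) ⊎ (Good s α v × Good u β t) → 1 ≤ X α β
            halves (inj₁ (p , q)) = ≤-trans (*-mono-≤ (1≤ι p) (1≤ι q)) (m≤m+n _ _)
            halves (inj₂ (p , q)) = ≤-trans (*-mono-≤ (1≤ι p) (1≤ι q)) (m≤n+m _ _)

        middle : ∀ {α} → α ∈ seqs m a →
          ∑ (seqs m (suc b)) (λ β → ι (Splits s t e a (α ++ β))) ≤ ∑ (seqs m b) (X α)
        middle {α} α∈ = begin
          ∑ (seqs m (suc b)) (λ β → ι (Splits s t e a (α ++ β)))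
            ≡⟨ ∑-prod _∷_ (allFin m) (seqs m b) _ ⟩
          ∑ (allFin m) (λ e′ → ∑ (seqs m b) (λ β → ι (Splits s t e a (α ++ e′ ∷ β))))
            ≤⟨ ∑-mono (allFin m) (λ e′ → ∑-mono (seqs m b) (λ β → case (∈seqs⁻ a α∈))) ⟩
          ∑ (allFin m) (λ e′ → ∑ (seqs m b) (λ β → ι (e′ ≡ e) * X α β))
            ≡⟨ ∑-cong (allFin m) (λ e′ → ∑-*ˡ (seqs m b) (ι (e′ ≡ e)) (X α)) ⟩
          ∑ (allFin m) (λ e′ → ι (e′ ≡ e) * ∑ (seqs m b) (X α))
            ≤⟨ ∑-single e _ ⟩
          ∑ (seqs m b) (X α) ∎

      count-0 : ∀ s t → count 0 s t ≤ 1
      count-0 s t = ≤-trans (≤-reflexive (+-identityʳ _)) ι≤1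

      count-1 : ∀ s t → count 1 s t ≤ 1
      count-1 s t = begin
        count 1 s t
          ≡⟨ ∑-prod _∷_ (allFin m) (seqs m 0) _ ⟩
        ∑ (allFin m) (λ e → ι (Good s (e ∷ []) t) + 0)
          ≤⟨ ∑-mono (allFin m) (λ e → ≤-trans (≤-reflexive (+-identityʳ _)) (ι-mono joins)) ⟩
        ∑ (allFin m) (λ e → ι (Joins G e s t))
          ≤⟨ ∑-atMostOne (λ e → Joins G e s t) (allFin⁺ m) joins-unique ⟩
        1 ∎
        where
        open ≤-Reasoning
        joins : ∀ {e} → Good s (e ∷ []) t → Joins G e s t
        joins g with _ , j , refl ← run g = j

      module Bound (r-injective : ∀ {e x} → r e ≡ r x → e ≡ x) (f K : ℕ) .{{_ : NonZero f}}
        (blocked : ∀ {e u v} τ → e ∈ₛ U → Joins G e u v → Run u τ v → length τ < 2 * K →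
                   All (λ x → x ∈ₛ U × r x < r e) τ → Any (_∈ₛ F e) τ)
        (indegree : ∀ {x} → x ∈ₛ U → ∑ (allFin m) (λ e → ι (e ∈ₛ U × x ∈ₛ F e)) ≤ 2 * f) where

        Hits : E → E → Set
        Hits x e = e ∈ₛ U × (x ∈ₛ F e ⊎ e ≡ x)

        hits-bound : ∀ {x} → x ∈ₛ U → ∑ (allFin m) (λ e → ι (Hits x e)) ≤ 3 * f
        hits-bound {x} x∈ = begin
          ∑ (allFin m) (λ e → ι (Hits x e))
            ≤⟨ ∑-mono (allFin m) (λ e → ι-elim λ
                 { (e∈ , inj₁ x∈F) → ≤-trans (1≤ι (e∈ , x∈F)) (m≤n+m _ (ι (e ≡ x)))
                 ; (e∈ , inj₂ e≡x) → ≤-trans (1≤ι e≡x) (m≤m+n _ _) }) ⟩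
          ∑ (allFin m) (λ e → ι (e ≡ x) + ι (e ∈ₛ U × x ∈ₛ F e))
            ≡⟨ ∑-+ (allFin m) (λ e → ι (e ≡ x)) _ ⟩
          ∑ (allFin m) (λ e → ι (e ≡ x)) + ∑ (allFin m) (λ e → ι (e ∈ₛ U × x ∈ₛ F e))
            -- The single edge `e ≡ x` is paid for by 1 ≤ `f`.
            ≤⟨ +-mono-≤ (≤-trans (∑-atMostOne (_≡ x) (allFin⁺ m) λ { refl refl → refl }) (>-nonZero⁻¹ f))
                  (indegree x∈) ⟩
          3 * f ∎
          where open ≤-Reasoning

        -- The number of ways in which an edge x of π′ can point to an edge e at an odd
        -- offset a of π.
        L : Fin n → Fin n → List E → List E → ℕ
        L s t π π′ = ∑ (upTo (length π)) λ a → ∑ (allFin m) λ x → ι (x ∈ π′ × x ∈ₛ U) *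
          ∑ (allFin m) (λ e → ι (Hits x e) * ι (Splits s t e a π))

        -- The heaviest edge e of π closes a walk α⁻¹ π′ β⁻¹ of length 2|π| - 1,
        -- which must meet F e; since the edges of π are apart, it does so inside π′.
        one-sided : ∀ {s t π π′} (let k = length π) → 2 ≤ k → k ≤ K → length π′ ≡ k →
          Good s π t → Good s π′ t →
          ∀ α e β → π ≡ α ++ e ∷ β → Odd (length α) → Alt true α → Alt true β →
          All (λ x → r x ≤ r e) π → All (λ x → r x ≤ r e) π′ → 1 ≤ L s t π π′
        one-sided {s} {t} {_} {π′} 2≤k k≤K len′ g g′ α e β refl odd altα altβ top top′ =
          conclude (found (em {e ∈ π′}))
          where
          open ≤-Reasoning
          r₁ = run-++⁻ α (run g)
          p = proj₁ r₁
          q = proj₁ (proj₂ (proj₂ r₁))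
          runα : Run s α p
          runα = proj₁ (proj₂ r₁)
          joins : Joins G e p q
          joins = proj₁ (proj₂ (proj₂ (proj₂ r₁)))
          runβ : Run q β t
          runβ = proj₂ (proj₂ (proj₂ (proj₂ r₁)))
          inα = All.++⁻ˡ α (inU g)
          inβ = All.tail (All.++⁻ʳ α (inU g))
          e∈U : e ∈ₛ U
          e∈U = All.head (All.++⁻ʳ α (inU g))
          aps = allPairs-++⁻ α (apart g)
          apβ′ : AllPairs Apart (e ∷ β)
          apβ′ = proj₁ (proj₂ aps)
          apα : All (λ x → Apart x e) α
          apα = All.map All.head (proj₂ (proj₂ aps))
          apβ : All (Apart e) β
          apβ with a ∷ _ ← apβ′ = a
          apartβ : AllPairs Apart β
          apartβ with _ ∷ a ← apβ′ = a

          goodα : Good s α p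
          goodα = good runα altα (proj₁ aps) inα
          goodβ : Good q β t
          goodβ = good runβ altβ apartβ inβ

          splits : Splits s t e (length α) (α ++ e ∷ β)
          splits = α , β , refl , refl , odd , side joins
            where
            side : Joins G e p q → let u , v = ends G e in
              (Good s α u × Good v β t) ⊎ (Good s α v × Good u β t)
            side (inj₁ eq) rewrite eq = inj₁ (goodα , goodβ)
            side (inj₂ eq) rewrite eq = inj₂ (goodα , goodβ)

          detour : List E
          detour = reverse α ++ π′ ++ reverse β

          run-detour : Run p detour q
          run-detour = run-++⁺ (reverse α) (run-reverse α runα)
            (run-++⁺ π′ (run g′) (run-reverse β runβ))

          k≡ : length (α ++ e ∷ β) ≡ length α + suc (length β)
          k≡ = length-++ α

          length-detour : length detour < 2 * K
          length-detour = begin-strict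
            length detour
              ≡⟨ trans (length-++ (reverse α)) (cong₂ _+_ (length-reverse α)
                   (trans (length-++ π′) (cong₂ _+_ (trans len′ k≡) (length-reverse β)))) ⟩
            length α + (length α + suc (length β) + length β)
              <⟨ n<1+n _ ⟩
            suc (length α + (length α + suc (length β) + length β))
              ≡⟨ solve 2 (λ a b → con 1 :+ (a :+ (a :+ (con 1 :+ b) :+ b)) := con 2 :* (a :+ (con 1 :+
                    b))) refl (length α) (length β) ⟩
            2 * (length α + suc (length β))
              ≡⟨ cong (2 *_) k≡ ⟨
            2 * length (α ++ e ∷ β)
              ≤⟨ *-monoʳ-≤ 2 k≤K ⟩
            2 * K ∎
            where open +-*-Solver

          lighter : ∀ {x} → r x ≤ r e → x ≢ e → r x < r e
          lighter x≤ x≢ = ≤∧≢⇒< x≤ (x≢ ∘ r-injective)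

          Below : E → Set
          Below x = x ∈ₛ U × r x < r e

          belowα : All Below α
          belowα = All.zipWith (λ { (x∈ , x≤ , x≢ , _) → x∈ , lighter x≤ x≢ })
            (inα , All.zip (All.++⁻ˡ α top , apα))

          belowβ : All Below β
          belowβ = All.zipWith (λ { (x∈ , x≤ , e≢ , _) → x∈ , lighter x≤ (e≢ ∘ sym) })
            (inβ , All.zip (All.tail (All.++⁻ʳ α top) , apβ))

          below-reverse : ∀ {γ} → All Below γ → All Below (reverse γ)
          below-reverse h = All.tabulate (All.lookup h ∘ Any.reverse⁻)

          found : Dec (e ∈ π′) → ∃ λ x → x ∈ π′ × x ∈ₛ U × Hits x e
          -- Here the closing walk would contain `e` itself, so blocking does not apply to it;
          -- instead `e` points to itself.
          found (yes e∈π′) = e , e∈π′ , e∈U , e∈U , inj₂ refl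
          found (no e∉π′)
            with Any.++⁻ (reverse α) (blocked detour e∈U joins run-detour length-detour
                   (All.++⁺ (below-reverse belowα) (All.++⁺
                     (All.tabulate λ x∈ → All.lookup (inU g′) x∈
                       , lighter (All.lookup top′ x∈) λ { refl → e∉π′ x∈ })
                     (below-reverse belowβ))))
          ... | inj₁ x∈F with _ , x∈ , x∈Fe ← find (Any.reverse⁻ x∈F) =
            ⊥-elim (proj₂ (proj₂ (All.lookup apα x∈)) x∈Fe)
          ... | inj₂ x∈F with Any.++⁻ π′ x∈F
          ... | inj₁ y∈F with x , x∈ , x∈Fe ← find y∈F =
            x , x∈ , All.lookup (inU g′) x∈ , e∈U , inj₁ x∈Fe
          ... | inj₂ y∈F with _ , x∈ , x∈Fe ← find (Any.reverse⁻ y∈F) =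
            ⊥-elim (proj₁ (proj₂ (All.lookup apβ x∈)) x∈Fe)

          conclude : (∃ λ x → x ∈ π′ × x ∈ₛ U × Hits x e) → 1 ≤ L s t (α ++ e ∷ β) π′
          conclude (x , x∈π′ , x∈U , hits) = begin
            1
              ≤⟨ *-mono-≤ (1≤ι (x∈π′ , x∈U))
                   (≤-trans (*-mono-≤ (1≤ι hits) (1≤ι splits)) (∑-∈ (term (length α) x) (∈-allFin e))) ⟩
            ι (x ∈ π′ × x ∈ₛ U) * ∑ (allFin m) (term (length α) x)
              ≤⟨ ∑-∈ (λ x → ι (x ∈ π′ × x ∈ₛ U) * ∑ (allFin m) (term (length α) x)) (∈-allFin x) ⟩
            ∑ (allFin m) (λ x → ι (x ∈ π′ × x ∈ₛ U) * ∑ (allFin m) (term (length α) x))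
              ≤⟨ ∑-∈ (λ a → ∑ (allFin m) λ x → ι (x ∈ π′ × x ∈ₛ U) * ∑ (allFin m) (term a x)) (∈-upTo⁺ a<k) ⟩
            L s t (α ++ e ∷ β) π′ ∎
            where
            term : ℕ → E → E → ℕ
            term a x y = ι (Hits x y) * ι (Splits s t y a (α ++ e ∷ β))
            a<k : length α < length (α ++ e ∷ β)
            a<k = subst (length α <_) (sym k≡) (m<m+n (length α) (s≤s z≤n))

        two-sided : ∀ {s t π π′} → 2 ≤ length π → length π ≤ K → length π′ ≡ length π →
          Good s π t → Good s π′ t → 1 ≤ L s t π π′ + L s t π′ π
        two-sided {s} {t} {π} {π′} 2≤k k≤K len′ g g′
          with α , e , β , eq , o , altα , altβ , top ← heaviest π (alt g) 2≤k
          with α′ , e′ , β′ , eq′ , o′ , altα′ , altβ′ , top′ ← heaviest π′ (alt g′) (subst (2 ≤_) (sym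
                len′) 2≤k)
          with ≤-total (r e′) (r e)
        ... | inj₁ e′≤e = ≤-trans (one-sided 2≤k k≤K len′ g g′ α e β eq o altα altβ top
                (All.map (λ x≤ → ≤-trans x≤ e′≤e) top′)) (m≤m+n _ _)
        ... | inj₂ e≤e′ = ≤-trans (one-sided (subst (2 ≤_) (sym len′) 2≤k) (subst (_≤ K) (sym len′) k≤K)
                (sym len′) g′ g α′ e′ β′ eq′ o′ altα′ altβ′ top′
                (All.map (λ x≤ → ≤-trans x≤ e≤e′) top)) (m≤n+m _ _)

        -- For a fixed `π′` there are at most `K` offsets, at most `K` edges `x` of `π′`, at most
        -- `3 * f` edges `e` hit by each `x`, and at most `T` sequences split by `e` at the offset.
        L-total : ∀ {s t k π′ T} → k ≤ K → length π′ ≤ K →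
          (∀ a e → a < k → ∑ (seqs m k) (λ π → ι (Splits s t e a π)) ≤ T) →
          ∑ (seqs m k) (λ π → L s t π π′) ≤ K * (K * (3 * f * T))
        L-total {s} {t} {k} {π′} {T} k≤K len′ bound = begin
          ∑ Π (λ π → L s t π π′)
            ≤⟨ ∑-mono-∈ Π (λ {π} π∈ → ≤-reflexive (cong (λ l → ∑ (upTo l) (λ a → Y a π)) (∈seqs⁻ k π∈))) ⟩
          ∑ Π (λ π → ∑ (upTo k) (λ a → Y a π))
            ≡⟨ ∑-swap Π (upTo k) (λ π a → Y a π) ⟩
          ∑ (upTo k) (λ a → ∑ Π (Y a))
            ≤⟨ ∑-mono-∈ (upTo k) (λ a∈ → offset _ (∈-upTo⁻ a∈)) ⟩
          ∑ (upTo k) (λ _ → K * (3 * f * T))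
            ≡⟨ trans (∑-const (upTo k) _) (cong (_* (K * (3 * f * T))) (length-upTo k)) ⟩
          k * (K * (3 * f * T))
            ≤⟨ *-monoˡ-≤ _ k≤K ⟩
          K * (K * (3 * f * T)) ∎
          where
          open ≤-Reasoning
          Π = seqs m k
          c : E → ℕ
          c x = ι (x ∈ π′ × x ∈ₛ U)
          Y : ℕ → List E → ℕ
          Y a π = ∑ (allFin m) λ x → c x * ∑ (allFin m) (λ e → ι (Hits x e) * ι (Splits s t e a π))

          offset : ∀ a → a < k → ∑ Π (Y a) ≤ K * (3 * f * T)
          offset a a<k = begin
            ∑ Π (Y a)
              ≡⟨ ∑-swap Π (allFin m) (λ π x → c x * ∑ (allFin m) (λ e → ι (Hits x e) * ι (Splits s t e a
                    π))) ⟩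
            ∑ (allFin m) (λ x → ∑ Π λ π → c x * ∑ (allFin m) (λ e → ι (Hits x e) * ι (Splits s t e a π)))
              ≡⟨ ∑-cong (allFin m) (λ x → trans (∑-*ˡ Π (c x) _) (cong (c x *_)
                   (trans (∑-swap Π (allFin m) _) (∑-cong (allFin m) λ e → ∑-*ˡ Π (ι (Hits x e)) _)))) ⟩
            ∑ (allFin m) (λ x → c x * ∑ (allFin m) (λ e → ι (Hits x e) * ∑ Π (λ π → ι (Splits s t e a π))))
              ≤⟨ ∑-mono (allFin m) (λ x → ≤-trans (ι-*-mono (hit x)) (*-monoˡ-≤ (3 * f * T) (ι-mono proj₁))) ⟩
            ∑ (allFin m) (λ x → ι (x ∈ π′) * (3 * f * T))
              ≡⟨ ∑-*ʳ (allFin m) _ (3 * f * T) ⟩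
            ∑ (allFin m) (λ x → ι (x ∈ π′)) * (3 * f * T)
              ≤⟨ *-monoˡ-≤ (3 * f * T) (≤-trans (∑∈≤length π′) len′) ⟩
            K * (3 * f * T) ∎
            where
            hit : ∀ x → x ∈ π′ × x ∈ₛ U →
              ∑ (allFin m) (λ e → ι (Hits x e) * ∑ Π (λ π → ι (Splits s t e a π))) ≤ 3 * f * T
            hit x (_ , x∈U) = begin
              ∑ (allFin m) (λ e → ι (Hits x e) * ∑ Π (λ π → ι (Splits s t e a π)))
                ≤⟨ ∑-mono (allFin m) (λ e → *-monoʳ-≤ (ι (Hits x e)) (bound a e a<k)) ⟩
              ∑ (allFin m) (λ e → ι (Hits x e) * T)
                ≡⟨ ∑-*ʳ (allFin m) _ T ⟩
              ∑ (allFin m) (λ e → ι (Hits x e)) * T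
                ≤⟨ *-monoˡ-≤ T (hits-bound x∈U) ⟩
              3 * f * T ∎

        -- The constant is 2 · 3 · 2: two roles in a pair of trails, `3 * f` edges hit by an edge,
        -- two directions of the splitting edge.
        Q : ℕ
        Q = 12 * (K * K * f)

        -- Double counting of ordered pairs of good trails: the trail with the heavier maximum is
        -- recovered from the other one through `L`. Dividing by the number of trails then gives a
        -- recursion.
        count-square : ∀ {s t k T} → 2 ≤ k → k ≤ K →
          (∀ a e → a < k → ∑ (seqs m k) (λ π → ι (Splits s t e a π)) ≤ 2 * T) →
          count k s t * count k s t ≤ count k s t * (Q * T)
        count-square {s} {t} {k} {T} 2≤k k≤K bound = begin
          N * N
            ≡⟨ ∑-*ʳ Π g N ⟨
          ∑ Π (λ π → g π * N)
            ≡⟨ ∑-cong Π (λ π → sym (∑-*ˡ Π (g π) g)) ⟩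
          ∑ Π (λ π → ∑ Π (λ π′ → g π * g π′))
            ≤⟨ ∑-mono-∈ Π (λ {π} π∈ → ∑-mono-∈ Π λ {π′} π′∈ → ι-*-ι-mono {a = L s t π π′} {L s t π′ π}
                 (two-sided (subst (2 ≤_) (sym (∈seqs⁻ k π∈)) 2≤k) (subst (_≤ K) (sym (∈seqs⁻ k π∈)) k≤K)
                   (trans (∈seqs⁻ k π′∈) (sym (∈seqs⁻ k π∈))))) ⟩
          ∑ Π (λ π → ∑ Π (λ π′ → g π′ * L s t π π′ + g π * L s t π′ π))
            ≡⟨ trans (∑-cong Π (λ π → ∑-+ Π (λ π′ → g π′ * L s t π π′) (λ π′ → g π * L s t π′ π))) (∑-+ Π
                  _ _) ⟩
          ∑ Π (λ π → ∑ Π (λ π′ → g π′ * L s t π π′)) + ∑ Π (λ π → ∑ Π (λ π′ → g π * L s t π′ π))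
            -- Exchanging the names of the two trails makes both halves the same sum.
            ≡⟨ cong (_+ ∑ Π (λ π → ∑ Π (λ π′ → g π * L s t π′ π))) (∑-swap Π Π (λ π π′ → g π′ * L s t π π′)) ⟩
          ∑ Π (λ π → ∑ Π (λ π′ → g π * L s t π′ π)) + ∑ Π (λ π → ∑ Π (λ π′ → g π * L s t π′ π))
            ≤⟨ +-mono-≤ half half ⟩
          N * D + N * D
            ≡⟨ solve 4 (λ N K f T → N :* (K :* (K :* (con 3 :* f :* (con 2 :* T)))) :+ N :* (K :* (K :*
                  (con 3 :* f :* (con 2 :* T))))
                  := N :* (con 12 :* (K :* K :* f) :* T)) refl N K f T ⟩
          N * (Q * T) ∎
          where
          open ≤-Reasoning
          open +-*-Solver
          Π = seqs m k
          g : List E → ℕ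
          g π = ι (Good s π t)
          N = count k s t
          D = K * (K * (3 * f * (2 * T)))
          half : ∑ Π (λ π → ∑ Π (λ π′ → g π * L s t π′ π)) ≤ N * D
          half = begin
            ∑ Π (λ π → ∑ Π (λ π′ → g π * L s t π′ π))
              ≡⟨ ∑-cong Π (λ π → ∑-*ˡ Π (g π) _) ⟩
            ∑ Π (λ π → g π * ∑ Π (λ π′ → L s t π′ π))
              ≤⟨ ∑-mono-∈ Π (λ {π} π∈ → *-monoʳ-≤ (g π)
                   (L-total k≤K (subst (_≤ K) (sym (∈seqs⁻ k π∈)) k≤K) bound)) ⟩
            ∑ Π (λ π → g π * D)
              ≡⟨ ∑-*ʳ Π g D ⟩
            N * D ∎

        -- The induction is strong because the parts of a split can have any smaller lengths.
        -- Lengths 0 and 1 admit at most one trail, the latter because the graph is simple.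
        count-bound : ∀ k → k ≤ K → ∀ s t → count k s t ≤ Q ^ ⌊ k /2⌋
        count-bound = <-rec _ step
          where
          step : ∀ k → (∀ {j} → j < k → j ≤ K → ∀ s t → count j s t ≤ Q ^ ⌊ j /2⌋) →
            k ≤ K → ∀ s t → count k s t ≤ Q ^ ⌊ k /2⌋
          step 0 _ _ s t = count-0 s t
          step 1 _ _ s t = count-1 s t
          step k@(suc (suc j)) ih k≤K s t = cancel (count k s t) (count-square (s≤s (s≤s z≤n)) k≤K splits)
            where
            open ≤-Reasoning
            cancel : ∀ N {B} → N * N ≤ N * B → N ≤ B
            cancel zero    _ = z≤n
            cancel (suc N) h = *-cancelˡ-≤ (suc N) h

            splits : ∀ a e → a < k →
              ∑ (seqs m k) (λ π → ι (Splits s t e a π)) ≤ 2 * Q ^ ⌊ j /2⌋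
            splits a e a<k with em {Odd a}
            -- `Splits` carries the oddness of the offset, so even offsets contribute nothing.
            ... | no ¬odd = ≤-trans (≤-reflexive
                    (∑-none (seqs m k) (Splits s t e a) λ { _ (_ , _ , _ , _ , o , _) → ¬odd o })) z≤n
            ... | yes odd with b , eq ← m≤n⇒∃[o]m+o≡n a<k = begin
              ∑ (seqs m k) (λ π → ι (Splits s t e a π))
                ≡⟨ cong (λ l → ∑ (seqs m l) (λ π → ι (Splits s t e a π))) k≡ ⟩
              ∑ (seqs m (a + suc b)) (λ π → ι (Splits s t e a π))
                ≤⟨ splits-bound a b (ih a<k (<⇒≤ (<-≤-trans a<k k≤K))) (ih b<k (<⇒≤ (<-≤-trans b<k k≤K)))
                      s t e ⟩
              2 * (Q ^ ⌊ a /2⌋ * Q ^ ⌊ b /2⌋)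
                ≡⟨ cong (2 *_) (sym (^-distribˡ-+-* Q ⌊ a /2⌋ ⌊ b /2⌋)) ⟩
              2 * Q ^ (⌊ a /2⌋ + ⌊ b /2⌋)
                ≡⟨ cong (λ h → 2 * Q ^ h) (suc-injective (sym (trans (cong ⌊_/2⌋ k≡) (⌊odd+suc/2⌋ a b
                      odd)))) ⟩
              2 * Q ^ ⌊ j /2⌋ ∎
              where
              k≡ : k ≡ a + suc b
              k≡ = trans (sym eq) (sym (+-suc a b))
              b<k : b < k
              b<k = subst (b <_) (sym k≡) (m≤n+m (suc b) a)

-- Random samples and the lower bound on the number of trails

module Sampling where

  open import Axiom.ExcludedMiddle using (ExcludedMiddle)
  open import Data.Bool using (Bool; true; false; not)
  open import Data.Empty using (⊥-elim)
  open import Data.Fin using (Fin)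
  open import Data.Fin.Subset
    using (Subset; ∣_∣; _∩_; _-_; _⊆_; inside; outside) renaming (_∈_ to _∈ₛ_; _∉_ to _∉ₛ_)
  open import Data.Fin.Subset.Properties
    using (nonempty?; Empty-unique; ∣⊥∣≡0; x∈p⇒∣p-x∣<∣p∣; x∈p∧x≢y⇒x∈p-y; p─q⊆p; x∈p∩q⁻; p∩q⊆q; drop-∷-⊆)
  open import Data.List using (List; []; _∷_; length; allFin; replicate; cartesianProductWith)
  open import Data.List.Membership.Propositional using (_∈_)
  open import Data.List.Membership.Propositional.Properties using (∈-allFin)
  open import Data.List.Properties using (length-tabulate)
  open import Data.List.Relation.Unary.All using (All; []; _∷_)
  import Data.List.Relation.Unary.All as All
  open import Data.List.Relation.Unary.AllPairs using (AllPairs; []; _∷_)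
  import Data.List.Relation.Unary.AllPairs as AllPairs
  open import Data.List.Relation.Unary.Any using (here; there)
  open import Data.List.Relation.Unary.Unique.Propositional using (Unique)
  open import Data.List.Relation.Unary.Unique.Propositional.Properties using (allFin⁺)
  open import Data.Nat using (ℕ; zero; suc; _+_; _*_; _^_; _≤_; _<_; z≤n; s≤s; _≤?_; >-nonZero)
  open import Data.Nat.Properties
  open import Data.Nat.Solver using (module +-*-Solver)
  open import Data.Product using (∃; ∃₂; _×_; _,_; proj₁)
  open import Data.Sum using (inj₁; swap)
  open import Data.Unit using (tt)
  open import Data.Vec using (_∷_; []; here; there)
  open import Function using (_∘_)
  open import Level using (0ℓ)
  open import Relation.Binary.PropositionalEquality
  open import Relation.Nullary using (¬_; yes; no)
  open import Defs using (Graph; size; Joins)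

  open Summation
  open TrailCounting

  -- An element is taken with weight 1 and left out with weight d: sums over samples d m are
  -- (1 + d)^m times expectations over a random subset of density 1/(1 + d).

  samples : ℕ → ∀ m → List (Subset m)
  samples d zero    = [] ∷ []
  samples d (suc m) = cartesianProductWith _∷_ (inside ∷ replicate d outside) (samples d m)

  ∑-samples-suc : ∀ d m (f : Subset (suc m) → ℕ) → ∑ (samples d (suc m)) f ≡
    ∑ (samples d m) (f ∘ (inside ∷_)) + d * ∑ (samples d m) (f ∘ (outside ∷_))
  ∑-samples-suc d m f = trans (∑-prod _∷_ (inside ∷ replicate d outside) (samples d m) f)
    (cong (∑ (samples d m) (f ∘ (inside ∷_)) +_) (∑-replicate d outside _))

  ∑-samples-1 : ∀ d m → ∑ (samples d m) (λ _ → 1) ≡ suc d ^ m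
  ∑-samples-1 d zero    = refl
  ∑-samples-1 d (suc m) = trans (∑-samples-suc d m _) (cong (suc d *_) (∑-samples-1 d m))

  -- The expected size of a sample of `U` is ∣U∣/(1 + d), here with denominators cleared so that
  -- everything stays in ℕ.
  ∑-samples-size : ∀ d {m} (U : Subset m) →
    ∑ (samples d m) (λ S → ∣ S ∩ U ∣) * suc d ≡ ∣ U ∣ * suc d ^ m
  ∑-samples-size d []           = refl
  ∑-samples-size d {suc m} (b ∷ U) = trans (cong (_* suc d) (∑-samples-suc d m _)) (split b)
    where
    open ≡-Reasoning
    open +-*-Solver
    X = ∑ (samples d m) (λ S → ∣ S ∩ U ∣)
    split : ∀ b → (∑ (samples d m) (λ S → ∣ (inside ∷ S) ∩ (b ∷ U) ∣) + d * X) * suc d ≡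
      ∣ b ∷ U ∣ * suc d ^ suc m
    split true = begin
      (∑ (samples d m) (λ S → 1 + ∣ S ∩ U ∣) + d * X) * suc d
        ≡⟨ cong (λ y → (y + d * X) * suc d) (trans (∑-+ (samples d m) (λ _ → 1) _) (cong (_+ X)
              (∑-samples-1 d m))) ⟩
      (suc d ^ m + X + d * X) * suc d
        ≡⟨ solve 3 (λ p x d → (p :+ x :+ d :* x) :* (con 1 :+ d) := (con 1 :+ d) :* p :+ (con 1 :+ d) :*
              (x :* (con 1 :+ d))) refl (suc d ^ m) X d ⟩
      suc d * suc d ^ m + suc d * (X * suc d)
        ≡⟨ cong (λ y → suc d * suc d ^ m + suc d * y) (∑-samples-size d U) ⟩
      suc d * suc d ^ m + suc d * (∣ U ∣ * suc d ^ m)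
        ≡⟨ solve 3 (λ c p u → c :* p :+ c :* (u :* p) := (con 1 :+ u) :* (c :* p)) refl (suc d) (suc d ^
              m) ∣ U ∣ ⟩
      suc ∣ U ∣ * suc d ^ suc m ∎
    split false = begin
      suc d * X * suc d          ≡⟨ *-assoc (suc d) X (suc d) ⟩
      suc d * (X * suc d)        ≡⟨ cong (suc d *_) (∑-samples-size d U) ⟩
      suc d * (∣ U ∣ * suc d ^ m) ≡⟨ solve 3 (λ c p u → c :* (u :* p) := u :* (c :* p)) refl (suc d) (suc
            d ^ m) ∣ U ∣ ⟩
      ∣ U ∣ * suc d ^ suc m       ∎

  module Expectation (em : ExcludedMiddle 0ℓ) where

    open Indicator em

    -- A given set survives the sampling with probability (1 + d)^-∣X∣, since its elements are
    -- chosen independently.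
    ∑-samples-⊆ : ∀ d {m} (X : Subset m) →
      ∑ (samples d m) (λ S → ι (X ⊆ S)) * suc d ^ ∣ X ∣ ≤ suc d ^ m
    ∑-samples-⊆ d [] = ≤-trans (≤-reflexive (*-identityʳ _)) (≤-trans (≤-reflexive (+-identityʳ _)) ι≤1)
    ∑-samples-⊆ d {suc m} (b ∷ X) = ≤-trans (≤-reflexive (cong (_* suc d ^ ∣ b ∷ X ∣) (∑-samples-suc d m
          _))) (split b)
      where
      open ≤-Reasoning
      open +-*-Solver
      Y = ∑ (samples d m) (λ S → ι (X ⊆ S))
      hit miss : Bool → ℕ
      hit  b = ∑ (samples d m) (λ S → ι (b ∷ X ⊆ inside ∷ S))
      miss b = ∑ (samples d m) (λ S → ι (b ∷ X ⊆ outside ∷ S))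
      hit≤ : ∀ b → hit b ≤ Y
      hit≤ b = ∑-mono (samples d m) λ S → ι-mono drop-∷-⊆
      scale : ∀ {a} → a ≤ suc d * Y → a * suc d ^ ∣ X ∣ ≤ suc d ^ suc m
      scale {a} h = begin
        a * suc d ^ ∣ X ∣           ≤⟨ *-monoˡ-≤ (suc d ^ ∣ X ∣) h ⟩
        suc d * Y * suc d ^ ∣ X ∣   ≡⟨ *-assoc (suc d) Y _ ⟩
        suc d * (Y * suc d ^ ∣ X ∣) ≤⟨ *-monoʳ-≤ (suc d) (∑-samples-⊆ d X) ⟩
        suc d ^ suc m             ∎
      split : ∀ b → (hit b + d * miss b) * suc d ^ ∣ b ∷ X ∣ ≤ suc d ^ suc m
      split false = scale (+-mono-≤ (hit≤ false) (*-monoʳ-≤ d (∑-mono (samples d m) λ S → ι-mono drop-∷-⊆)))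
      split true = begin
        (hit true + d * miss true) * (suc d * suc d ^ ∣ X ∣)
          ≡⟨ cong (λ y → (hit true + d * y) * (suc d * suc d ^ ∣ X ∣))
               (∑-none (samples d m) (λ S → true ∷ X ⊆ false ∷ S) λ _ h → absurd (h here)) ⟩
        (hit true + d * 0) * (suc d * suc d ^ ∣ X ∣)
          ≡⟨ solve 4 (λ h d c p → (h :+ d :* con 0) :* (c :* p) := c :* h :* p) refl (hit true) d (suc d)
                (suc d ^ ∣ X ∣) ⟩
        suc d * hit true * suc d ^ ∣ X ∣
          ≤⟨ scale (*-monoʳ-≤ (suc d) (hit≤ true)) ⟩
        suc d ^ suc m ∎
        where
        absurd : ∀ {m} {S : Subset m} {A : Set} → Fin.zero ∈ₛ false ∷ S → A
        absurd ()

    -- A repeated entry would survive for free, so the exponent `length τ` relies on distinct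
    -- entries; this is why the trails must not repeat edges.
    ∑-samples-All : ∀ d {m} {τ : List (Fin m)} → Unique τ →
      ∑ (samples d m) (λ S → ι (All (_∈ₛ S) τ)) * suc d ^ length τ ≤ suc d ^ m
    ∑-samples-All d {m} {τ} u = ≤-trans
      (*-mono-≤ (∑-mono (samples d m) λ S → ι-mono (⊆⁺ {S}))
                (^-monoʳ-≤ (suc d) length≤))
      (∑-samples-⊆ d ⟪ _∈ τ ⟫)
      where
      ⊆⁺ : ∀ {S} → All (_∈ₛ S) τ → ⟪ _∈ τ ⟫ ⊆ S
      ⊆⁺ all e∈ = All.lookup all (∈⟪⟫⁻ e∈)
      length≤ : length τ ≤ ∣ ⟪ _∈ τ ⟫ ∣
      length≤ = ≤-trans (length≤∑∈ τ u) (≤-trans (∑-mono (allFin m) λ e → ι-mono ∈⟪⟫⁺)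
        (≤-reflexive (sym ∣ ⟪ _∈ τ ⟫ ∣≡∑)))

    ∣p∣≤1+∣p-x∣ : ∀ {m} (p : Subset m) x → ∣ p ∣ ≤ suc ∣ p - x ∣
    ∣p∣≤1+∣p-x∣ {m} p x = begin
      ∣ p ∣                                                   ≡⟨ ∣ p ∣≡∑ ⟩
      ∑ (allFin m) (λ e → ι (e ∈ₛ p))                         ≤⟨ ∑-mono (allFin m) removed ⟩
      ∑ (allFin m) (λ e → ι (e ≡ x) + ι (e ∈ₛ p - x))         ≡⟨ ∑-+ (allFin m) _ _ ⟩
      ∑ (allFin m) (λ e → ι (e ≡ x)) + ∑ (allFin m) (λ e → ι (e ∈ₛ p - x))
        ≤⟨ +-mono-≤ (∑-atMostOne (_≡ x) (allFin⁺ m) λ { refl refl → refl }) (≤-reflexive (sym ∣ p - x ∣≡∑)) ⟩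
      suc ∣ p - x ∣ ∎
      where
      open ≤-Reasoning
      removed : ∀ e → ι (e ∈ₛ p) ≤ ι (e ≡ x) + ι (e ∈ₛ p - x)
      removed e with em {e ≡ x}
      ... | yes _ = ≤-trans ι≤1 (s≤s z≤n)
      ... | no e≢ = ι-mono λ e∈ → x∈p∧x≢y⇒x∈p-y e∈ e≢

    x∉p-x : ∀ {m} (p : Subset m) {x} → x ∉ₛ p - x
    x∉p-x (true  ∷ p) {Fin.zero} ()
    x∉p-x (false ∷ p) {Fin.zero} ()
    x∉p-x (_ ∷ p) {Fin.suc x} (there x∈) = x∉p-x p x∈

  module Supersaturation {n} (G : Graph n) (r : Fin (size G) → ℕ) (F : Fin (size G) → Subset (size G))
    (U : Subset (size G)) (em : ExcludedMiddle 0ℓ) (r-injective : ∀ {e x} → r e ≡ r x → e ≡ x) where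

    open Indicator em
    open Expectation em
    open Walks G
    open Trails G r F U
    open Count em

    private m = size G

    ≺-irrefl : ∀ b {e} → ¬ e ≺[ b ] e
    ≺-irrefl true  = <-irrefl refl
    ≺-irrefl false = <-irrefl refl

    ≺-trans : ∀ b {e x y} → e ≺[ b ] x → x ≺[ b ] y → e ≺[ b ] y
    ≺-trans true  p q = <-trans p q
    ≺-trans false p q = <-trans q p

    ≺-connex : ∀ b {e x} → ¬ e ≺[ b ] x → ¬ x ≺[ b ] e → e ≡ x
    ≺-connex true  p q = r-injective (≤-antisym (≮⇒≥ q) (≮⇒≥ p))
    ≺-connex false p q = r-injective (≤-antisym (≮⇒≥ p) (≮⇒≥ q))

    ⊀-≺-trans : ∀ b {e x y} → ¬ x ≺[ b ] e → x ≺[ b ] y → e ≺[ b ] y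
    ⊀-≺-trans true  p q = ≤-<-trans (≮⇒≥ p) q
    ⊀-≺-trans false p q = <-≤-trans q (≮⇒≥ p)

    minimal : ∀ b (P : E → Set) (xs : List E) {y} → P y →
      ∃ λ y′ → P y′ × (∀ {x} → x ∈ xs → P x → ¬ x ≺[ b ] y′)
    minimal b P []       py = _ , py , λ ()
    minimal b P (x ∷ xs) p₀ with y , py , min ← minimal b P xs p₀ with em {P x × x ≺[ b ] y}
    ... | yes (px , x≺y) = x , px , λ
      { (here refl) _ → ≺-irrefl b
      ; (there z∈) pz z≺x → min z∈ pz (≺-trans b z≺x x≺y) }
    ... | no ¬x = y , py , λ
      { (here refl) px x≺y → ¬x (px , x≺y)
      ; (there z∈) → min z∈ }

    Inc : E → Fin n → Set
    Inc e v = ∃ λ u → Joins G e v u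

    module _ (b : Bool) (S : Subset m) where

      Min : Fin n → E → Set
      Min v e = e ∈ₛ S × Inc e v × (∀ {x} → x ∈ₛ S → Inc x v → ¬ x ≺[ b ] e)

      trimmed : Subset m
      trimmed = ⟪ (λ e → e ∈ₛ S × ∀ v → Inc e v → ∃ λ x → x ∈ₛ S × Inc x v × x ≺[ b ] e) ⟫

      -- Every lost edge is extreme at one of its ends, and a vertex has at most one extreme edge
      -- because the ranks are distinct.
      ∣S∣≤∣trimmed∣+n : ∣ S ∣ ≤ ∣ trimmed ∣ + n
      ∣S∣≤∣trimmed∣+n = begin
        ∣ S ∣
          ≡⟨ ∣ S ∣≡∑ ⟩
        ∑ (allFin m) (λ e → ι (e ∈ₛ S))
          ≤⟨ ∑-mono (allFin m) (λ e → ι-elim (kept e)) ⟩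
        ∑ (allFin m) (λ e → ι (e ∈ₛ trimmed) + ∑ (allFin n) (λ v → ι (Min v e)))
          ≡⟨ ∑-+ (allFin m) _ _ ⟩
        ∑ (allFin m) (λ e → ι (e ∈ₛ trimmed)) + ∑ (allFin m) (λ e → ∑ (allFin n) (λ v → ι (Min v e)))
          ≡⟨ cong₂ _+_ (sym ∣ trimmed ∣≡∑) (∑-swap (allFin m) (allFin n) _) ⟩
        ∣ trimmed ∣ + ∑ (allFin n) (λ v → ∑ (allFin m) (λ e → ι (Min v e)))
          ≤⟨ +-monoʳ-≤ ∣ trimmed ∣ (∑-mono (allFin n) λ v → ∑-atMostOne (Min v) (allFin⁺ m)
               λ (x∈ , ix , minx) (y∈ , iy , miny) → ≺-connex b (miny x∈ ix) (minx y∈ iy)) ⟩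
        ∣ trimmed ∣ + ∑ (allFin n) (λ _ → 1)
          ≡⟨ cong (∣ trimmed ∣ +_) (trans (∑-const (allFin n) 1) (trans (*-identityʳ _) (length-tabulate
                _))) ⟩
        ∣ trimmed ∣ + n ∎
        where
        open ≤-Reasoning
        kept : ∀ e → e ∈ₛ S → 1 ≤ ι (e ∈ₛ trimmed) + ∑ (allFin n) (λ v → ι (Min v e))
        kept e e∈ with em {∃ λ v → Min v e}
        ... | yes (v , min) = ≤-trans (≤-trans (1≤ι min) (∑-∈ (λ v → ι (Min v e)) (∈-allFin v))) (m≤n+m _
              (ι (e ∈ₛ trimmed)))
        ... | no ¬min = ≤-trans (1≤ι (∈⟪⟫⁺ (e∈ , smaller))) (m≤m+n _ _)
          where
          smaller : ∀ v → Inc e v → ∃ λ x → x ∈ₛ S × Inc x v × x ≺[ b ] e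
          smaller v inc with em {∃ λ x → x ∈ₛ S × Inc x v × x ≺[ b ] e}
          ... | yes p = p
          ... | no ¬p = ⊥-elim (¬min (v , e∈ , inc , λ x∈ ix x≺e → ¬p (_ , x∈ , ix , x≺e)))

    -- Each step deletes the extreme edges at all vertices, so that the edge
    -- prepended to a trail in the remaining graph is automatically new.
    alternating-trail : ∀ k b (S : Subset m) → k * n < ∣ S ∣ → ∃₂ λ s t → ∃ λ τ →
      length τ ≡ suc k × Run s τ t × Alt b τ × Unique τ × All (_∈ₛ S) τ
    alternating-trail zero b S 0<S with nonempty? S
    ... | yes (e , e∈) = _ , _ , e ∷ [] , refl , (_ , inj₁ refl , refl) , tt , [] ∷ [] , e∈ ∷ []
    ... | no empty = ⊥-elim (<-irrefl (sym (trans (cong ∣_∣ (Empty-unique empty)) (∣⊥∣≡0 m))) 0<S)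
    alternating-trail (suc k) b S kn<S
      with alternating-trail k (not b) (trimmed b S)
             (+-cancelʳ-< n (k * n) ∣ trimmed b S ∣ (<-≤-trans (subst (_< ∣ S ∣) (+-comm n (k * n)) kn<S)
                   (∣S∣≤∣trimmed∣+n b S)))
    ... | s , t , e₂ ∷ τ , len , (v , j₂ , run) , alt , u , e₂∈ ∷ τ∈
      -- As `e₂` survived the trimming, some edge `x` at `s` precedes it; the extreme edge `e₁` at
      -- `s` then precedes it too, which continues the alternation.
      with e₂∈S , smaller ← ∈⟪⟫⁻ e₂∈
      with x , x∈ , ix , x≺ ← smaller s (v , j₂)
      with e₁ , (e₁∈ , u₁ , j₁) , min ← minimal b (λ e → e ∈ₛ S × Inc e s) (allFin m) (x∈ , ix) =
        u₁ , t , e₁ ∷ e₂ ∷ τ , cong suc len , (s , swap j₁ , v , j₂ , run)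
        , (⊀-≺-trans b (min (∈-allFin x) (x∈ , ix)) x≺ , alt)
        , All.map (λ { y∈ refl → e₁∉ y∈ }) (e₂∈ ∷ τ∈) ∷ u
        , e₁∈ ∷ All.map (proj₁ ∘ ∈⟪⟫⁻) (e₂∈ ∷ τ∈)
        where
        e₁∉ : e₁ ∉ₛ trimmed b S
        e₁∉ e∈ = let _ , sm = ∈⟪⟫⁻ e∈
                     y , y∈ , iy , y≺ = sm s (u₁ , j₁)
                 in min (∈-allFin y) (y∈ , iy) y≺

    IsGood : List E → Set
    IsGood τ = ∃₂ λ s t → Good s τ t

    -- Nothing prevents `F e` from containing `e`. Requiring `x ≢ e` makes a conflict consist of two
    -- distinct edges, which survive sampling together with probability c^-2.
    Conflict : Subset m → E → E → Set
    Conflict S e x = e ∈ₛ S × x ∈ₛ S × x ∈ₛ F e × x ≢ e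

    goods : ℕ → Subset m → ℕ
    goods k S = ∑ (seqs m k) (λ τ → ι (IsGood τ × All (_∈ₛ S) τ))

    conflicts : Subset m → ℕ
    conflicts S = ∑ (allFin m) (λ e → ∑ (allFin m) (λ x → ι (Conflict S e x)))

    p-x⊆p : ∀ (p : Subset m) x → p - x ⊆ p
    p-x⊆p p x = p─q⊆p p _

    conflicts-mono : ∀ {S S′} → S ⊆ S′ → conflicts S ≤ conflicts S′
    conflicts-mono S⊆ = ∑-mono (allFin m) λ e → ∑-mono (allFin m) λ x →
      ι-mono λ (e∈ , x∈ , rest) → S⊆ e∈ , S⊆ x∈ , rest

    goods-mono : ∀ {k S S′} → S ⊆ S′ → goods k S ≤ goods k S′
    goods-mono {k} S⊆ = ∑-mono (seqs m k) λ τ → ι-mono λ (g , τ∈) → g , All.map S⊆ τ∈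

    ι-< : ∀ {P Q : Set} → ¬ P → Q → ι P < ι Q
    ι-< ¬p q = subst₂ _<_ (sym (ι-no ¬p)) (sym (ι-yes q)) (s≤s z≤n)

    apart-trail : ∀ {S τ} → ¬ (∃₂ λ e x → Conflict S e x) → All (_∈ₛ S) τ → Unique τ → AllPairs Apart τ
    apart-trail none []        []       = []
    apart-trail none (e∈ ∷ τ∈) (e∉ ∷ u) =
      All.zipWith (λ (x∈ , e≢x) → e≢x
        , (λ x∈F → none (_ , _ , e∈ , x∈ , x∈F , e≢x ∘ sym))
        , (λ e∈F → none (_ , _ , x∈ , e∈ , e∈F , e≢x))) (τ∈ , e∉)
      ∷ apart-trail none τ∈ u

    -- As long as more than `k * n` edges are left, there is a conflict or, without conflicts, an
    -- alternating trail that is automatically good. Deleting one of its edges destroys at least one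
    -- counted object, so the number of deletions is at most the number of objects. The bound `l` on
    -- the size only drives the induction.
    supersaturation : ∀ k l S → ∣ S ∣ ≤ l → S ⊆ U → ∣ S ∣ ≤ goods (suc k) S + conflicts S + k * n
    supersaturation k zero    S S≤l S⊆U = ≤-trans S≤l z≤n
    supersaturation k (suc l) S S≤l S⊆U with ∣ S ∣ ≤? k * n
    ... | yes small = ≤-trans small (m≤n+m _ (goods (suc k) S + conflicts S))
    ... | no big with em {∃₂ λ e x → Conflict S e x}
    ...   | yes (e , x , c@(e∈ , x∈ , _)) = begin
      ∣ S ∣
        ≤⟨ ∣p∣≤1+∣p-x∣ S x ⟩
      suc ∣ S - x ∣
        ≤⟨ s≤s (supersaturation k l (S - x) (≤-pred (≤-trans (x∈p⇒∣p-x∣<∣p∣ x∈) S≤l)) (S⊆U ∘ p-x⊆p S x)) ⟩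
      suc (goods (suc k) (S - x) + conflicts (S - x) + k * n)
        ≡⟨ cong (_+ k * n) (+-suc (goods (suc k) (S - x)) (conflicts (S - x))) ⟨
      goods (suc k) (S - x) + suc (conflicts (S - x)) + k * n
        ≤⟨ +-monoˡ-≤ (k * n) (+-mono-≤ (goods-mono {suc k} (p-x⊆p S x)) fewer) ⟩
      goods (suc k) S + conflicts S + k * n ∎
      where
      open ≤-Reasoning
      mono : ∀ e′ x′ → ι (Conflict (S - x) e′ x′) ≤ ι (Conflict S e′ x′)
      mono e′ x′ = ι-mono λ (e∈ , x∈ , rest) → p-x⊆p S x e∈ , p-x⊆p S x x∈ , rest
      fewer : conflicts (S - x) < conflicts S
      fewer = ∑-mono-< (allFin m) (λ e′ → ∑-mono (allFin m) (mono e′)) (∈-allFin e)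
        (∑-mono-< (allFin m) (mono e) (∈-allFin x) (ι-< (λ (_ , x∈′ , _) → x∉p-x S x∈′) c))
    ...   | no none with alternating-trail k true S (≰⇒> big)
    ...     | s , t , τ@(e ∷ _) , len , run , alt , u , τ∈@(e∈ ∷ _) = begin
      ∣ S ∣
        ≤⟨ ∣p∣≤1+∣p-x∣ S e ⟩
      suc ∣ S - e ∣
        ≤⟨ s≤s (supersaturation k l (S - e) (≤-pred (≤-trans (x∈p⇒∣p-x∣<∣p∣ e∈) S≤l)) (S⊆U ∘ p-x⊆p S e)) ⟩
      suc (goods (suc k) (S - e) + conflicts (S - e) + k * n)
        ≤⟨ +-monoˡ-≤ (k * n) (+-mono-≤ fewer (conflicts-mono (p-x⊆p S e))) ⟩
      goods (suc k) S + conflicts S + k * n ∎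
      where
      open ≤-Reasoning
      τ∈seqs : τ ∈ seqs m (suc k)
      τ∈seqs = subst (λ l → τ ∈ seqs m l) len (∈seqs⁺ τ)
      fewer : goods (suc k) (S - e) < goods (suc k) S
      fewer = ∑-mono-< (seqs m (suc k)) (λ τ′ → ι-mono λ (g , τ′∈) → g , All.map (p-x⊆p S e) τ′∈) τ∈seqs
        (ι-< (λ { (_ , e∈′ ∷ _) → x∉p-x S e∈′ })
             ((s , t , good run alt (apart-trail none τ∈ u) (All.map S⊆U τ∈)) , τ∈))

    module Amplification (f : ℕ) (F-small : ∀ {e} → e ∈ₛ U → ∣ F e ∣ ≤ f) (d : ℕ) where

      c : ℕ
      c = suc d

      private Ω = samples d m

      good-samples : ∀ K → ∑ Ω (λ S → goods K (S ∩ U)) * c ^ K ≤ ∑ (seqs m K) (ι ∘ IsGood) * c ^ m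
      good-samples K = begin
        ∑ Ω (λ S → goods K (S ∩ U)) * c ^ K
          ≡⟨ cong (_* c ^ K) (∑-swap Ω (seqs m K) _) ⟩
        ∑ (seqs m K) (λ τ → ∑ Ω (λ S → ι (IsGood τ × All (_∈ₛ S ∩ U) τ))) * c ^ K
          ≡⟨ ∑-*ʳ (seqs m K) _ (c ^ K) ⟨
        ∑ (seqs m K) (λ τ → ∑ Ω (λ S → ι (IsGood τ × All (_∈ₛ S ∩ U) τ)) * c ^ K)
          ≤⟨ ∑-mono-∈ (seqs m K) each ⟩
        ∑ (seqs m K) (λ τ → ι (IsGood τ) * c ^ m)
          ≡⟨ ∑-*ʳ (seqs m K) _ (c ^ m) ⟩
        ∑ (seqs m K) (ι ∘ IsGood) * c ^ m ∎
        where
        open ≤-Reasoning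
        each : ∀ {τ} → τ ∈ seqs m K →
          ∑ Ω (λ S → ι (IsGood τ × All (_∈ₛ S ∩ U) τ)) * c ^ K ≤ ι (IsGood τ) * c ^ m
        each {τ} τ∈ with em {IsGood τ}
        ... | no ¬g = ≤-trans (≤-reflexive (cong (_* c ^ K) (∑-none Ω _ λ _ (g , _) → ¬g g))) z≤n
        ... | yes (s , t , g) = begin
          ∑ Ω (λ S → ι (IsGood τ × All (_∈ₛ S ∩ U) τ)) * c ^ K
            ≤⟨ *-monoˡ-≤ (c ^ K) (∑-mono Ω λ S → ι-mono λ (_ , τ∈) → All.map (proj₁ ∘ x∈p∩q⁻ S U) τ∈) ⟩
          ∑ Ω (λ S → ι (All (_∈ₛ S) τ)) * c ^ K
            ≡⟨ cong (λ l → ∑ Ω (λ S → ι (All (_∈ₛ S) τ)) * c ^ l) (∈seqs⁻ K τ∈) ⟨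
          ∑ Ω (λ S → ι (All (_∈ₛ S) τ)) * c ^ length τ
            ≤⟨ ∑-samples-All d (AllPairs.map proj₁ (apart g)) ⟩
          c ^ m
            ≡⟨ *-identityˡ (c ^ m) ⟨
          1 * c ^ m ∎

      -- There are at most `∣ U ∣ * f` pairs, since each edge of `U` has an F-set of at most `f`
      -- elements, and each pair survives with probability c^-2.
      conflict-samples : ∑ Ω (λ S → conflicts (S ∩ U)) * c ^ 2 ≤ ∣ U ∣ * f * c ^ m
      conflict-samples = begin
        ∑ Ω (λ S → conflicts (S ∩ U)) * c ^ 2
          ≡⟨ cong (_* c ^ 2) (trans (∑-swap Ω (allFin m) _) (∑-cong (allFin m) λ e → ∑-swap Ω (allFin m) _)) ⟩
        ∑ (allFin m) (λ e → ∑ (allFin m) (λ x → ∑ Ω (λ S → ι (Conflict (S ∩ U) e x)))) * c ^ 2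
          ≡⟨ trans (sym (∑-*ʳ (allFin m) _ (c ^ 2))) (∑-cong (allFin m) λ e → sym (∑-*ʳ (allFin m) _ (c ^
                2))) ⟩
        ∑ (allFin m) (λ e → ∑ (allFin m) (λ x → ∑ Ω (λ S → ι (Conflict (S ∩ U) e x)) * c ^ 2))
          ≤⟨ ∑-mono (allFin m) (λ e → ∑-mono (allFin m) (each e)) ⟩
        ∑ (allFin m) (λ e → ∑ (allFin m) (λ x → ι (e ∈ₛ U) * ι (x ∈ₛ F e) * c ^ m))
          ≡⟨ trans (∑-cong (allFin m) λ e → ∑-*ʳ (allFin m) _ (c ^ m)) (∑-*ʳ (allFin m) _ (c ^ m)) ⟩
        ∑ (allFin m) (λ e → ∑ (allFin m) (λ x → ι (e ∈ₛ U) * ι (x ∈ₛ F e))) * c ^ m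
          ≡⟨ cong (_* c ^ m) (∑-cong (allFin m) λ e → trans (∑-*ˡ (allFin m) (ι (e ∈ₛ U)) _) (cong (ι (e
                ∈ₛ U) *_) (sym ∣ F e ∣≡∑))) ⟩
        ∑ (allFin m) (λ e → ι (e ∈ₛ U) * ∣ F e ∣) * c ^ m
          ≤⟨ *-monoˡ-≤ (c ^ m) (∑-mono (allFin m) λ e → ι-*-mono F-small) ⟩
        ∑ (allFin m) (λ e → ι (e ∈ₛ U) * f) * c ^ m
          ≡⟨ cong (_* c ^ m) (trans (∑-*ʳ (allFin m) _ f) (cong (_* f) (sym ∣ U ∣≡∑))) ⟩
        ∣ U ∣ * f * c ^ m ∎
        where
        open ≤-Reasoning
        each : ∀ e x → ∑ Ω (λ S → ι (Conflict (S ∩ U) e x)) * c ^ 2 ≤ ι (e ∈ₛ U) * ι (x ∈ₛ F e) * c ^ m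
        each e x with em {e ∈ₛ U × x ∈ₛ F e × x ≢ e}
        ... | no ¬p = ≤-trans (≤-reflexive (cong (_* c ^ 2)
                (∑-none Ω _ λ {S} _ (e∈ , _ , x∈F , x≢e) → ¬p (p∩q⊆q S U e∈ , x∈F , x≢e)))) z≤n
        ... | yes (e∈ , x∈F , x≢e) = begin
          ∑ Ω (λ S → ι (Conflict (S ∩ U) e x)) * c ^ 2
            ≤⟨ *-monoˡ-≤ (c ^ 2) (∑-mono Ω λ S → ι-mono λ (e∈ , x∈ , _) →
                 proj₁ (x∈p∩q⁻ S U e∈) ∷ proj₁ (x∈p∩q⁻ S U x∈) ∷ []) ⟩
          ∑ Ω (λ S → ι (All (_∈ₛ S) (e ∷ x ∷ []))) * c ^ 2
            ≤⟨ ∑-samples-All d ((x≢e ∘ sym ∷ []) ∷ [] ∷ []) ⟩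
          c ^ m
            ≤⟨ m≤n*m (c ^ m) (ι (e ∈ₛ U) * ι (x ∈ₛ F e)) {{>-nonZero (*-mono-≤ (1≤ι e∈) (1≤ι x∈F))}} ⟩
          ι (e ∈ₛ U) * ι (x ∈ₛ F e) * c ^ m ∎

      -- This is the expectation of `supersaturation` for the sample `S ∩ U`, namely ∣U∣/c ≤ A/c^K +
      -- ∣U∣ f/c² + k n, multiplied by c^(K + 2).
      amplified : ∀ k (let K = suc k) → ∣ U ∣ * c ^ suc K ≤
        ∑ (seqs m K) (ι ∘ IsGood) * c ^ 2 + ∣ U ∣ * f * c ^ K + k * n * c ^ (2 + K)
      amplified k = *-cancelˡ-≤ (c ^ m) {{m^n≢0 c m}} (begin
        c ^ m * (∣ U ∣ * c ^ suc K)
          ≡⟨ solve 3 (λ p u q → p :* (u :* q) := u :* p :* q) refl (c ^ m) ∣ U ∣ (c ^ suc K) ⟩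
        ∣ U ∣ * c ^ m * c ^ suc K
          ≡⟨ cong (_* c ^ suc K) (∑-samples-size d U) ⟨
        T * c * c ^ suc K
          ≡⟨ *-assoc T c (c ^ suc K) ⟩
        T * c ^ (2 + K)
          ≤⟨ *-monoˡ-≤ (c ^ (2 + K)) T≤ ⟩
        (TA + TC + c ^ m * (k * n)) * (c * (c * c ^ K))
          ≡⟨ solve 6 (λ a b p kn c q → (a :+ b :+ p :* kn) :* (c :* (c :* q)) :=
                a :* q :* (c :* (c :* con 1)) :+ b :* (c :* (c :* con 1)) :* q :+ p :* (kn :* (c :* (c :*
                      q)))) refl TA TC (c ^ m) (k * n) c (c ^ K) ⟩
        TA * c ^ K * c ^ 2 + TC * c ^ 2 * c ^ K + c ^ m * (k * n * c ^ (2 + K))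
          ≤⟨ +-monoˡ-≤ _ (+-mono-≤ (*-monoˡ-≤ (c ^ 2) (good-samples K)) (*-monoˡ-≤ (c ^ K)
                conflict-samples)) ⟩
        A * c ^ m * c ^ 2 + ∣ U ∣ * f * c ^ m * c ^ K + c ^ m * (k * n * c ^ (2 + K))
          ≡⟨ solve 6 (λ a p s u q z → a :* p :* s :+ u :* p :* q :+ p :* z := p :* (a :* s :+ u :* q :+
                z)) refl
                A (c ^ m) (c ^ 2) (∣ U ∣ * f) (c ^ K) (k * n * c ^ (2 + K)) ⟩
        c ^ m * (A * c ^ 2 + ∣ U ∣ * f * c ^ K + k * n * c ^ (2 + K)) ∎)
        where
        open ≤-Reasoning
        open +-*-Solver
        K = suc k
        A = ∑ (seqs m K) (ι ∘ IsGood)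
        T = ∑ Ω (λ S → ∣ S ∩ U ∣)
        TA = ∑ Ω (λ S → goods K (S ∩ U))
        TC = ∑ Ω (λ S → conflicts (S ∩ U))
        T≤ : T ≤ TA + TC + c ^ m * (k * n)
        T≤ = begin
          T
            ≤⟨ ∑-mono Ω (λ S → supersaturation k ∣ S ∩ U ∣ (S ∩ U) ≤-refl (p∩q⊆q S U)) ⟩
          ∑ Ω (λ S → goods K (S ∩ U) + conflicts (S ∩ U) + k * n)
            ≡⟨ trans (∑-+ Ω _ (λ _ → k * n)) (cong₂ _+_ (∑-+ Ω (λ S → goods K (S ∩ U)) _) const) ⟩
          TA + TC + c ^ m * (k * n) ∎
          where
          const : ∑ Ω (λ _ → k * n) ≡ c ^ m * (k * n)
          const = trans (∑-cong Ω λ _ → sym (*-identityˡ (k * n)))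
            (trans (∑-*ʳ Ω (λ _ → 1) (k * n)) (cong (_* (k * n)) (∑-samples-1 d m)))

    ∑-IsGood : ∀ K {P} → (∀ s t → count K s t ≤ P) → ∑ (seqs m K) (ι ∘ IsGood) ≤ n * (n * P)
    ∑-IsGood K {P} bound = begin
      ∑ (seqs m K) (ι ∘ IsGood)
        ≤⟨ ∑-mono (seqs m K) (λ τ → ι-elim λ (s , t , g) → ≤-trans (1≤ι g)
             (≤-trans (∑-∈ (λ t → ι (Good s τ t)) (∈-allFin t)) (∑-∈ (λ s → ∑ (allFin n) (λ t → ι (Good s
                   τ t))) (∈-allFin s)))) ⟩
      ∑ (seqs m K) (λ τ → ∑ (allFin n) (λ s → ∑ (allFin n) (λ t → ι (Good s τ t))))
        ≡⟨ trans (∑-swap (seqs m K) (allFin n) _) (∑-cong (allFin n) λ s → ∑-swap (seqs m K) (allFin n) _) ⟩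
      ∑ (allFin n) (λ s → ∑ (allFin n) (λ t → count K s t))
        ≤⟨ ∑-mono (allFin n) (λ s → ∑-mono (allFin n) (bound s)) ⟩
      ∑ (allFin n) (λ _ → ∑ (allFin n) (λ _ → P))
        ≡⟨ trans (const (∑ (allFin n) (λ _ → P))) (cong (n *_) (const P)) ⟩
      n * (n * P) ∎
      where
      open ≤-Reasoning
      const : ∀ a → ∑ (allFin n) (λ _ → a) ≡ n * a
      const a = trans (∑-const (allFin n) a) (cong (_* a) (length-tabulate {n = n} (λ x → x)))

-- The greedy spanner and its number of edges

module GreedySpanner where

  open import Axiom.ExcludedMiddle using (ExcludedMiddle)
  open import Data.Empty using (⊥-elim)
  open import Data.Fin using (Fin)
  open import Data.Fin.Subset using (Subset; ∣_∣; _∪_; ⁅_⁆; ⊥) renaming (_∈_ to _∈ₛ_; _∉_ to _∉ₛ_)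
  open import Data.Fin.Subset.Properties using (∉⊥; x∈p∪q⁺; x∈p∪q⁻; x∈⁅x⁆; x∈⁅y⁆⇒x≡y)
  open import Data.List using ([]; _∷_; length; allFin; reverse)
  open import Data.List.Properties using (length-reverse)
  open import Data.List.Relation.Unary.All using (All; []; _∷_)
  import Data.List.Relation.Unary.All as All
  import Data.List.Relation.Unary.All.Properties as All
  open import Data.List.Relation.Unary.Any using (Any)
  import Data.List.Relation.Unary.Any.Properties as Any
  open import Data.Nat
    using (ℕ; zero; suc; _+_; _*_; _^_; _≤_; _<_; z≤n; s≤s; _≤?_; ⌊_/2⌋; NonZero; _/_; _%_; >-nonZero⁻¹)
  open import Data.Nat.DivMod using (m/n*n≤m; m≡m%n+[m/n]*n; m%n<n; /-monoˡ-≤; m*n/n≡m)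
  open import Data.Nat.Properties
  open import Data.Nat.Solver using (module +-*-Solver)
  open import Data.Product using (∃; ∃₂; _×_; _,_; proj₁; proj₂)
  open import Data.Sum using (_⊎_; inj₁; inj₂)
  open import Function using (_∘_)
  open import Level using (0ℓ)
  open import Relation.Binary.PropositionalEquality
  open import Relation.Nullary using (¬_; yes; no)
  open import Defs using (Graph; size; ends; Joins)

  open Summation
  open TrailCounting
  open Sampling

  ^-distribʳ-* : ∀ k a b → (a * b) ^ k ≡ a ^ k * b ^ k
  ^-distribʳ-* zero    a b = refl
  ^-distribʳ-* (suc k) a b = trans (cong (a * b *_) (^-distribʳ-* k a b))
    (solve 4 (λ a b p q → a :* b :* (p :* q) := a :* p :* (b :* q)) refl a b (a ^ k) (b ^ k))
    where open +-*-Solver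

  -- Put X = N c^(K + 1). The condition 4f ≤ c bounds the conflict term by X/4, and 4Knc ≤ N does
  -- the same for the last term, so X ≤ 2 A c². Comparing this with X ≥ 4 n c² c^K and A ≤ n² P
  -- gives the claim with a factor 2 to spare.
  edge-count : ∀ {N A n P f k d} (let K = suc k; c = suc d) .{{_ : NonZero n}} →
    N * c ^ suc K ≤ A * c ^ 2 + N * f * c ^ K + k * n * c ^ (2 + K) →
    A ≤ n * (n * P) → 4 * f ≤ c → c * (4 * (K * n)) ≤ N → c ^ K ≤ n * P
  edge-count {N} {A} {n} {P} {f} {k} {d} amplified A≤ 4f≤c 4Knc≤N =
    *-cancelˡ-≤ 2 (*-cancelˡ-≤ n (*-cancelʳ-≤ _ _ (c * c) (*-cancelˡ-≤ 2 bound)))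
    where
    open ≤-Reasoning
    open +-*-Solver
    K = suc k
    c = suc d
    p = c ^ K
    X = N * c ^ suc K
    4X≤ : 4 * X ≤ X + X + 4 * (A * c ^ 2)
    4X≤ = begin
      4 * X
        ≤⟨ *-monoʳ-≤ 4 amplified ⟩
      4 * (A * c ^ 2 + N * f * p + k * n * (c * (c * p)))
        ≡⟨ solve 7 (λ a N f p k n c → con 4 :* (a :+ N :* f :* p :+ k :* n :* (c :* (c :* p))) :=
              N :* (con 4 :* f) :* p :+ c :* (con 4 :* (k :* n)) :* (c :* p) :+ con 4 :* a) refl (A * c ^
                    2) N f p k n c ⟩
      N * (4 * f) * p + c * (4 * (k * n)) * (c * p) + 4 * (A * c ^ 2)
        ≤⟨ +-monoˡ-≤ _ (+-mono-≤ (*-monoˡ-≤ p (*-monoʳ-≤ N 4f≤c)) (*-monoˡ-≤ (c * p) (≤-trans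
             (*-monoʳ-≤ c (*-monoʳ-≤ 4 (*-monoˡ-≤ n (n≤1+n k)))) 4Knc≤N))) ⟩
      N * c * p + X + 4 * (A * c ^ 2)
        ≡⟨ cong (λ y → y + X + 4 * (A * c ^ 2)) (*-assoc N c p) ⟩
      X + X + 4 * (A * c ^ 2) ∎
    2X≤ : 2 * X ≤ 4 * (A * c ^ 2)
    2X≤ = +-cancelˡ-≤ (X + X) _ _ (subst (_≤ X + X + 4 * (A * c ^ 2))
      (solve 1 (λ x → con 4 :* x := x :+ x :+ con 2 :* x) refl X) 4X≤)
    bound : 2 * (n * (2 * p) * (c * c)) ≤ 2 * (n * (2 * (n * P)) * (c * c))
    bound = begin
      2 * (n * (2 * p) * (c * c))
        ≡⟨ solve 3 (λ n c p → con 2 :* (n :* (con 2 :* p) :* (c :* c)) := c :* (con 4 :* (con 1 :* n)) :*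
              (c :* p)) refl n c p ⟩
      c * (4 * (1 * n)) * (c * p)
        ≤⟨ *-monoˡ-≤ (c * p) (≤-trans (*-monoʳ-≤ c (*-monoʳ-≤ 4 (*-monoˡ-≤ n {1} {K} (s≤s z≤n)))) 4Knc≤N) ⟩
      X
        ≤⟨ *-cancelˡ-≤ 2 (≤-trans 2X≤ (≤-reflexive (*-assoc 2 2 (A * c ^ 2)))) ⟩
      2 * (A * c ^ 2)
        ≤⟨ *-monoʳ-≤ 2 (*-monoˡ-≤ (c ^ 2) A≤) ⟩
      2 * (n * (n * P) * c ^ 2)
        -- The spare factor 2 is given away here, so that both sides cancel in the same shape.
        ≤⟨ m≤m+n _ (2 * (n * (n * P) * c ^ 2)) ⟩
      2 * (n * (n * P) * c ^ 2) + 2 * (n * (n * P) * c ^ 2)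
        ≡⟨ solve 3 (λ n P c → con 2 :* (n :* (n :* P) :* (c :* (c :* con 1))) :+ con 2 :* (n :* (n :* P)
              :* (c :* (c :* con 1))) :=
             con 2 :* (n :* (con 2 :* (n :* P)) :* (c :* c))) refl n P c ⟩
      2 * (n * (2 * (n * P)) * (c * c)) ∎

  module Spanner {n} (G : Graph n) (r : Fin (size G) → ℕ) (em : ExcludedMiddle 0ℓ)
    (r-injective : ∀ {e x} → r e ≡ r x → e ≡ x) (f k : ℕ) .{{_ : NonZero f}} where

    open Indicator em
    open Walks G

    private
      m = size G
      K = suc k

    Detour : (E → Set) → E → Set
    Detour P e = ∃ λ τ → Run (proj₁ (ends G e)) τ (proj₂ (ends G e)) × length τ < 2 * K × All P τ

    detour-map : ∀ {P Q : E → Set} {e} → (∀ {x} → P x → Q x) → Detour P e → Detour Q e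
    detour-map h (τ , run , len , all) = τ , run , len , All.map h all

    Spans : Subset m → E → Subset m → Set
    Spans H e F = Detour (λ x → x ∈ₛ H × x ∉ₛ F × r x ≤ r e) e

    -- `Spans` admits the rank of `e`, so that an edge of `H` is its own detour. The strict
    -- inequality here excludes `e`, so blocking survives the insertion of `e` and of heavier edges.
    Blocks : Subset m → E → Subset m → Set
    Blocks H e F = ¬ Detour (λ x → x ∈ₛ H × x ∉ₛ F × r x < r e) e

    1<2K : 1 < 2 * K
    1<2K = *-monoʳ-≤ 2 (>-nonZero⁻¹ K)

    -- Edges are examined by increasing rank, and the first invariant says that all edges of `H`
    -- have rank below `i`. So an insertion never changes the part of `H` lighter than an edge
    -- already inserted, and its blocking set stays valid.
    greedy : ∀ i → ∃ λ H →
      (∀ {e} → e ∈ₛ H → r e < i) ×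
      (∀ e F → r e < i → ∣ F ∣ ≤ f → e ∉ₛ F → Spans H e F) ×
      (∀ e → e ∈ₛ H → ∃ λ F → ∣ F ∣ ≤ f × Blocks H e F)
    greedy zero = ⊥ , (⊥-elim ∘ ∉⊥) , (λ _ _ ()) , λ _ → ⊥-elim ∘ ∉⊥
    greedy (suc i) with H , below , spans , blocks ← greedy i
      with em {∃₂ λ e F → r e ≡ i × ∣ F ∣ ≤ f × ¬ Spans H e F}
    ... | no ¬new = H , m<n⇒m<1+n ∘ below , spans′ , blocks
      where
      spans′ : ∀ e F → r e < suc i → ∣ F ∣ ≤ f → e ∉ₛ F → Spans H e F
      spans′ e F (s≤s r≤i) F≤f e∉F with m≤n⇒m<n∨m≡n r≤i
      ... | inj₁ r<i = spans e F r<i F≤f e∉F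
      ... | inj₂ r≡i with em {Spans H e F}
      ...   | yes d = d
      ...   | no ¬d = ⊥-elim (¬new (e , F , r≡i , F≤f , ¬d))
    ... | yes (e₀ , F₀ , refl , F₀≤f , ¬spans) = H′ , below′ , spans′ , blocks′
      where
      H′ = H ∪ ⁅ e₀ ⁆
      old : ∀ {x} → x ∈ₛ H → x ∈ₛ H′
      old = x∈p∪q⁺ ∘ inj₁
      new : e₀ ∈ₛ H′
      new = x∈p∪q⁺ (inj₂ (x∈⁅x⁆ e₀))
      case : ∀ {x} → x ∈ₛ H′ → x ∈ₛ H ⊎ x ≡ e₀
      case x∈ with x∈p∪q⁻ H ⁅ e₀ ⁆ x∈
      ... | inj₁ x∈H = inj₁ x∈H
      ... | inj₂ x∈e = inj₂ (x∈⁅y⁆⇒x≡y e₀ x∈e)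
      before : ∀ {x} → x ∈ₛ H′ → r x < r e₀ → x ∈ₛ H
      before x∈ r< with case x∈
      ... | inj₁ x∈H  = x∈H
      ... | inj₂ refl = ⊥-elim (<-irrefl refl r<)
      below′ : ∀ {e} → e ∈ₛ H′ → r e < suc (r e₀)
      below′ e∈ with case e∈
      ... | inj₁ e∈H  = m<n⇒m<1+n (below e∈H)
      ... | inj₂ refl = ≤-refl
      spans′ : ∀ e F → r e < suc (r e₀) → ∣ F ∣ ≤ f → e ∉ₛ F → Spans H′ e F
      spans′ e F (s≤s r≤) F≤f e∉F with m≤n⇒m<n∨m≡n r≤
      ... | inj₁ r< = detour-map (λ (x∈ , rest) → old x∈ , rest) (spans e F r< F≤f e∉F)
      ... | inj₂ r≡ with refl ← r-injective r≡ =
        e ∷ [] , (_ , inj₁ refl , refl) , 1<2K , (new , e∉F , ≤-refl) ∷ []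
      blocks′ : ∀ e → e ∈ₛ H′ → ∃ λ F → ∣ F ∣ ≤ f × Blocks H′ e F
      blocks′ e e∈ with case e∈
      ... | inj₁ e∈H = let F , F≤f , block = blocks e e∈H in
        F , F≤f , block ∘ detour-map λ (x∈ , x∉F , r<) → before x∈ (<-trans r< (below e∈H)) , x∉F , r<
      ... | inj₂ refl =
        F₀ , F₀≤f , ¬spans ∘ detour-map λ (x∈ , x∉F , r<) → before x∈ r< , x∉F , <⇒≤ r<

    module Size (H : Subset m) (blocks : ∀ e → e ∈ₛ H → ∃ λ F → ∣ F ∣ ≤ f × Blocks H e F) where

      choice : ∀ e → ∃ λ F → e ∈ₛ H → ∣ F ∣ ≤ f × Blocks H e F
      choice e with em {e ∈ₛ H}
      ... | yes e∈ = let F , p = blocks e e∈ in F , λ _ → p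
      ... | no e∉  = ⊥ , ⊥-elim ∘ e∉

      F : E → Subset m
      F e = proj₁ (choice e)

      indegree : E → ℕ
      indegree x = ∑ (allFin m) (λ e → ι (e ∈ₛ H × x ∈ₛ F e))

      U : Subset m
      U = ⟪ (λ x → x ∈ₛ H × indegree x ≤ 2 * f) ⟫

      U⇒H : ∀ {x} → x ∈ₛ U → x ∈ₛ H
      U⇒H = proj₁ ∘ ∈⟪⟫⁻

      F-small : ∀ {e} → e ∈ₛ H → ∣ F e ∣ ≤ f
      F-small {e} e∈ = proj₁ (proj₂ (choice e) e∈)

      blocked : ∀ {e u v} τ → e ∈ₛ U → Joins G e u v → Run u τ v → length τ < 2 * K →
        All (λ x → x ∈ₛ U × r x < r e) τ → Any (_∈ₛ F e) τ
      blocked {e} τ e∈ joins run len below with em {Any (_∈ₛ F e) τ}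
      ... | yes any = any
      ... | no none = ⊥-elim (proj₂ (proj₂ (choice e) (U⇒H e∈)) (oriented joins))
        where
        P : E → Set
        P x = x ∈ₛ H × x ∉ₛ F e × r x < r e
        all : All P τ
        all = All.zipWith (λ ((x∈ , r<) , x∉) → U⇒H x∈ , x∉ , r<) (below , All.¬Any⇒All¬ τ none)
        oriented : _ → Detour P e
        oriented (inj₁ eq) = τ
          , subst₂ (λ u v → Run u τ v) (sym (cong proj₁ eq)) (sym (cong proj₂ eq)) run , len , all
        oriented (inj₂ eq) = reverse τ
          , subst₂ (λ u v → Run u (reverse τ) v) (sym (cong proj₁ eq)) (sym (cong proj₂ eq)) (run-reverse
                τ run)
          , subst (_< 2 * K) (sym (length-reverse τ)) len
          , All.tabulate (All.lookup all ∘ Any.reverse⁻)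

      U-indegree : ∀ {x} → x ∈ₛ U → ∑ (allFin m) (λ e → ι (e ∈ₛ U × x ∈ₛ F e)) ≤ 2 * f
      U-indegree x∈ = ≤-trans (∑-mono (allFin m) λ e → ι-mono λ (e∈ , x∈F) → U⇒H e∈ , x∈F)
        (proj₂ (∈⟪⟫⁻ x∈))

      -- This is Markov's inequality: the indegrees add up to the sizes of the F-sets, at most ∣H∣ f
      -- in total, so at most half of the edges have indegree above `2 * f`.
      ∣H∣≤2∣U∣ : ∣ H ∣ ≤ 2 * ∣ U ∣
      ∣H∣≤2∣U∣ = +-cancelˡ-≤ ∣ H ∣ _ _ (begin
        ∣ H ∣ + ∣ H ∣
          ≤⟨ +-mono-≤ H≤U+D H≤U+D ⟩
        ∣ U ∣ + D + (∣ U ∣ + D)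
          ≡⟨ solve 2 (λ u d → u :+ d :+ (u :+ d) := con 2 :* d :+ con 2 :* u) refl ∣ U ∣ D ⟩
        2 * D + 2 * ∣ U ∣
          ≤⟨ +-monoˡ-≤ (2 * ∣ U ∣) (*-cancelʳ-≤ (2 * D) ∣ H ∣ f 2Df≤Hf) ⟩
        ∣ H ∣ + 2 * ∣ U ∣ ∎)
        where
        open ≤-Reasoning
        open +-*-Solver
        Heavy : E → Set
        Heavy x = x ∈ₛ H × ¬ indegree x ≤ 2 * f
        D = ∑ (allFin m) (ι ∘ Heavy)

        H≤U+D : ∣ H ∣ ≤ ∣ U ∣ + D
        H≤U+D = begin
          ∣ H ∣                                       ≡⟨ ∣ H ∣≡∑ ⟩
          ∑ (allFin m) (λ x → ι (x ∈ₛ H))             ≤⟨ ∑-mono (allFin m) split ⟩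
          ∑ (allFin m) (λ x → ι (x ∈ₛ U) + ι (Heavy x)) ≡⟨ ∑-+ (allFin m) _ _ ⟩
          ∑ (allFin m) (λ x → ι (x ∈ₛ U)) + D         ≡⟨ cong (_+ D) ∣ U ∣≡∑ ⟨
          ∣ U ∣ + D                                   ∎
          where
          split : ∀ x → ι (x ∈ₛ H) ≤ ι (x ∈ₛ U) + ι (Heavy x)
          split x with indegree x ≤? 2 * f
          ... | yes d≤ = ≤-trans (ι-mono λ x∈ → ∈⟪⟫⁺ (x∈ , d≤)) (m≤m+n _ _)
          ... | no d≰  = ≤-trans (ι-mono λ x∈ → x∈ , d≰) (m≤n+m _ (ι (x ∈ₛ U)))

        2Df≤Hf : 2 * D * f ≤ ∣ H ∣ * f
        2Df≤Hf = begin
          2 * D * f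
            ≡⟨ solve 2 (λ d f → con 2 :* d :* f := d :* (con 2 :* f)) refl D f ⟩
          D * (2 * f)
            ≡⟨ ∑-*ʳ (allFin m) _ (2 * f) ⟨
          ∑ (allFin m) (λ x → ι (Heavy x) * (2 * f))
            ≤⟨ ∑-mono (allFin m) (λ x → ≤-trans (ι-*-mono (λ (_ , d≰) → <⇒≤ (≰⇒> d≰)))
                 (≤-trans (*-monoˡ-≤ (indegree x) ι≤1) (≤-reflexive (*-identityˡ (indegree x))))) ⟩
          ∑ (allFin m) indegree
            ≡⟨ ∑-swap (allFin m) (allFin m) _ ⟩
          ∑ (allFin m) (λ e → ∑ (allFin m) (λ x → ι (e ∈ₛ H × x ∈ₛ F e)))
            ≤⟨ ∑-mono (allFin m) (λ e → ≤-trans (∑-mono (allFin m) λ x → ι-×)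
                 (≤-reflexive (trans (∑-*ˡ (allFin m) (ι (e ∈ₛ H)) _) (cong (ι (e ∈ₛ H) *_) (sym ∣ F e
                       ∣≡∑))))) ⟩
          ∑ (allFin m) (λ e → ι (e ∈ₛ H) * ∣ F e ∣)
            ≤⟨ ∑-mono (allFin m) (λ e → ι-*-mono F-small) ⟩
          ∑ (allFin m) (λ e → ι (e ∈ₛ H) * f)
            ≡⟨ trans (∑-*ʳ (allFin m) _ f) (cong (_* f) (sym ∣ H ∣≡∑)) ⟩
          ∣ H ∣ * f ∎

      open Trails G r F U
      open Count em
      open Bound r-injective f K blocked U-indegree
      open Supersaturation G r F U em r-injective

      -- The inverse density is c = ⌊∣U∣/(4Kn)⌋, the largest value that `edge-count` admits, and ∣U∣
      -- ≥ 16Kfn ensures c ≥ 4f. In the base 16Kn, one factor 2 is for passing from `U` to `H` and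
      -- another for the floor, as ∣U∣ ≤ 2c · 4Kn.
      size-bound : .{{_ : NonZero n}} → ∣ H ∣ ≤ 32 * (K * f * n) ⊎
        ∣ H ∣ ^ K ≤ (16 * (K * n)) ^ K * (n * (12 * (K * K * f)) ^ ⌊ K /2⌋)
      size-bound with 16 * (K * f * n) ≤? ∣ U ∣
      ... | no small = inj₁ (begin
        ∣ H ∣                  ≤⟨ ∣H∣≤2∣U∣ ⟩
        2 * ∣ U ∣              ≤⟨ *-monoʳ-≤ 2 (<⇒≤ (≰⇒> small)) ⟩
        2 * (16 * (K * f * n)) ≡⟨ *-assoc 2 16 (K * f * n) ⟨
        32 * (K * f * n)       ∎)
        where open ≤-Reasoning
      ... | yes large = inj₂ (dense {∣ U ∣ / q} refl)
        where
        open ≤-Reasoning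
        open +-*-Solver
        instance
          q≢0 : NonZero (4 * (K * n))
          q≢0 = m*n≢0 4 (K * n) {{_}} {{m*n≢0 K n}}
        q = 4 * (K * n)
        P = (12 * (K * K * f)) ^ ⌊ K /2⌋
        4f≤ : 4 * f ≤ ∣ U ∣ / q
        4f≤ = begin
          4 * f           ≡⟨ m*n/n≡m (4 * f) q ⟨
          4 * f * q / q   ≤⟨ /-monoˡ-≤ q (≤-trans (≤-reflexive
            (solve 3 (λ f K n → con 4 :* f :* (con 4 :* (K :* n)) := con 16 :* (K :* f :* n)) refl f K
                  n)) large) ⟩
          ∣ U ∣ / q       ∎

        dense : ∀ {c} → c ≡ ∣ U ∣ / q → ∣ H ∣ ^ K ≤ (16 * (K * n)) ^ K * (n * P)
        dense {zero}  eq = ⊥-elim (<⇒≱ (≤-trans (>-nonZero⁻¹ f) (m≤n*m f 4)) (subst (4 * f ≤_) (sym eq) 4f≤))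
        dense {suc d} eq = begin
          ∣ H ∣ ^ K                       ≤⟨ ^-monoˡ-≤ K H≤ ⟩
          (16 * (K * n) * suc d) ^ K      ≡⟨ ^-distribʳ-* K (16 * (K * n)) (suc d) ⟩
          (16 * (K * n)) ^ K * suc d ^ K  ≤⟨ *-monoʳ-≤ ((16 * (K * n)) ^ K) c^K≤ ⟩
          (16 * (K * n)) ^ K * (n * P)    ∎
          where
          c≤ : suc d * q ≤ ∣ U ∣
          c≤ = subst (λ c → c * q ≤ ∣ U ∣) (sym eq) (m/n*n≤m ∣ U ∣ q)
          H≤ : ∣ H ∣ ≤ 16 * (K * n) * suc d
          H≤ = begin
            ∣ H ∣
              ≤⟨ ∣H∣≤2∣U∣ ⟩
            2 * ∣ U ∣
              ≡⟨ cong (2 *_) (m≡m%n+[m/n]*n ∣ U ∣ q) ⟩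
            2 * (∣ U ∣ % q + ∣ U ∣ / q * q)
              ≡⟨ cong (λ c → 2 * (∣ U ∣ % q + c * q)) eq ⟨
            2 * (∣ U ∣ % q + suc d * q)
              ≤⟨ *-monoʳ-≤ 2 (+-monoˡ-≤ (suc d * q) (≤-trans (<⇒≤ (m%n<n ∣ U ∣ q)) (m≤n*m q (suc d)))) ⟩
            2 * (suc d * q + suc d * q)
              ≡⟨ solve 2 (λ c z → con 2 :* (c :* (con 4 :* z) :+ c :* (con 4 :* z)) := con 16 :* z :* c)
                    refl (suc d) (K * n) ⟩
            16 * (K * n) * suc d ∎
          open Amplification f (F-small ∘ U⇒H) d
          c^K≤ : suc d ^ K ≤ n * P
          c^K≤ = edge-count {k = k} (amplified k) (∑-IsGood K (count-bound K ≤-refl)) (subst (4 * f ≤_)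
                (sym eq) 4f≤) c≤

-- Integer roots and solving the inequality for the number of edges

module Roots where

  open import Data.Empty using (⊥-elim)
  open import Data.Nat
    using (zero; suc; _+_; _*_; _^_; _≤_; _<_; z≤n; s≤s; _≤?_; ⌊_/2⌋; NonZero; >-nonZero⁻¹)
  open import Data.Nat.Properties
  open import Data.Nat.Solver using (module +-*-Solver)
  open import Data.Product using (∃; _×_; _,_)
  open import Data.Sum using (_⊎_; inj₁; inj₂)
  open import Relation.Binary.PropositionalEquality
  open import Relation.Nullary using (yes; no)

  open GreedySpanner using (^-distribʳ-*)

  ^-cancelˡ-≤ : ∀ q .{{_ : NonZero q}} {a b} → a ^ q ≤ b ^ q → a ≤ b
  ^-cancelˡ-≤ q h = ≮⇒≥ λ b<a → <⇒≱ (^-monoˡ-< q b<a) h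

  floor-root : ∀ q .{{_ : NonZero q}} x → ∃ λ s → s ^ q ≤ x × x < suc s ^ q
  floor-root (suc q) zero = 0 , z≤n , >-nonZero⁻¹ (1 ^ suc q) {{m^n≢0 1 (suc q)}}
  floor-root q@(suc _) (suc x) with s , s^q≤x , x< ← floor-root q x with suc s ^ q ≤? suc x
  ... | yes s′≤ = suc s , s′≤ , ≤-<-trans x< (^-monoˡ-< q (n<1+n (suc s)))
  ... | no s′≰  = s , m≤n⇒m≤1+n s^q≤x , ≰⇒> s′≰

  -- The floor `s` of the root is at least 1 for a positive `x`, so s + 1 ≤ 2s.
  root : ∀ q .{{_ : NonZero q}} x .{{_ : NonZero x}} → ∃ λ s → 1 ≤ s × s ^ q ≤ x × x ≤ (2 * s) ^ q
  root q x with floor-root q x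
  ... | zero  , _  , x< = ⊥-elim (<⇒≱ (subst (x <_) (^-zeroˡ q) x<) (>-nonZero⁻¹ x))
  ... | suc s , s≤ , x< = suc s , s≤s z≤n , s≤ , ≤-trans (<⇒≤ x<)
    (^-monoˡ-≤ q (≤-trans (≤-reflexive (sym (+-comm (suc s) 1))) (+-monoʳ-≤ (suc s) (s≤s z≤n))))

  2*⌊n/2⌋ : ∀ n → 2 * ⌊ n /2⌋ ≡ n ⊎ suc (2 * ⌊ n /2⌋) ≡ n
  2*⌊n/2⌋ 0 = inj₁ refl
  2*⌊n/2⌋ 1 = inj₂ refl
  2*⌊n/2⌋ (suc (suc n)) with 2*⌊n/2⌋ n
  ... | inj₁ eq = inj₁ (trans (*-suc 2 ⌊ n /2⌋) (cong (2 +_) eq))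
  ... | inj₂ eq = inj₂ (trans (cong suc (*-suc 2 ⌊ n /2⌋)) (cong (2 +_) eq))

  2*⌊n/2⌋≤n : ∀ n → 2 * ⌊ n /2⌋ ≤ n
  2*⌊n/2⌋≤n n with 2*⌊n/2⌋ n
  ... | inj₁ eq = ≤-reflexive eq
  ... | inj₂ eq = <⇒≤ (≤-reflexive eq)

  -- Taking squares turns the exponent ⌊ K /2⌋ into 2 ⌊ K /2⌋ ≤ K for both parities.
  root-bound : ∀ {h n f s t} K .{{_ : NonZero K}} →
    h ^ K ≤ (16 * (K * n)) ^ K * (n * (12 * (K * K * f)) ^ ⌊ K /2⌋) →
    n ^ (K + 1) ≤ (2 * t) ^ K → f ^ (2 * ⌊ K /2⌋) ≤ (2 * s) ^ (2 * K) →
    h ≤ 256 * (K ^ 2 * s * t)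
  root-bound {h} {n} {f} {s} {t} K h^K≤ n≤ f≤ = ^-cancelˡ-≤ (2 * K) {{m*n≢0 2 K}} (begin
    h ^ (2 * K)
      ≡⟨ square h K ⟩
    h ^ K * h ^ K
      ≤⟨ *-mono-≤ h^K≤ h^K≤ ⟩
    (16 * (K * n)) ^ K * (n * R) * ((16 * (K * n)) ^ K * (n * R))
      ≡⟨ cong (λ y → y * (n * R) * (y * (n * R))) (trans (cong (_^ K) (sym (*-assoc 16 K n)))
            (^-distribʳ-* K (16 * K) n)) ⟩
    (16 * K) ^ K * n ^ K * (n * R) * ((16 * K) ^ K * n ^ K * (n * R))
      ≡⟨ solve 4 (λ a b n r → a :* b :* (n :* r) :* (a :* b :* (n :* r)) := (a :* a) :* ((b :* (n :* con
            1)) :* (b :* (n :* con 1))) :* (r :* r)) refl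
           ((16 * K) ^ K) (n ^ K) n R ⟩
    (16 * K) ^ K * (16 * K) ^ K * ((n ^ K * n ^ 1) * (n ^ K * n ^ 1)) * (R * R)
      ≡⟨ cong₂ (λ a b → a * (b * b) * (R * R)) (sym (square (16 * K) K)) (sym (^-distribˡ-+-* n K 1)) ⟩
    (16 * K) ^ (2 * K) * (n ^ (K + 1) * n ^ (K + 1)) * (R * R)
      ≤⟨ *-mono-≤ (*-monoʳ-≤ ((16 * K) ^ (2 * K)) (≤-trans (*-mono-≤ n≤ n≤) (≤-reflexive (sym (square (2
            * t) K))))) R²≤ ⟩
    (16 * K) ^ (2 * K) * (2 * t) ^ (2 * K) * ((4 * K) ^ (2 * K) * (2 * s) ^ (2 * K))
      ≡⟨ trans (cong₂ _*_ (sym (^-distribʳ-* (2 * K) (16 * K) (2 * t))) (sym (^-distribʳ-* (2 * K) (4 *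
            K) (2 * s)))) (sym (^-distribʳ-* (2 * K) _ _)) ⟩
    (16 * K * (2 * t) * (4 * K * (2 * s))) ^ (2 * K)
      -- 256 = 16 · 2 · 4 · 2, where both factors 2 come from the floors `t` and `s` of the roots,
      -- and 4 from bounding 12 by 4².
      ≡⟨ cong (_^ (2 * K)) (solve 3 (λ K s t → con 16 :* K :* (con 2 :* t) :* (con 4 :* K :* (con 2 :* s)) :=
           con 256 :* (K :* (K :* con 1) :* s :* t)) refl K s t) ⟩
    (256 * (K ^ 2 * s * t)) ^ (2 * K) ∎)
    where
    open ≤-Reasoning
    open +-*-Solver
    j = ⌊ K /2⌋
    R = (12 * (K * K * f)) ^ j
    square : ∀ a k → a ^ (2 * k) ≡ a ^ k * a ^ k
    square a k = trans (cong (λ l → a ^ (k + l)) (+-identityʳ k)) (^-distribˡ-+-* a k k)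
    R²≤ : R * R ≤ (4 * K) ^ (2 * K) * (2 * s) ^ (2 * K)
    R²≤ = begin
      R * R
        ≡⟨ square (12 * (K * K * f)) j ⟨
      (12 * (K * K * f)) ^ (2 * j)
        -- Raising 12 to 16 makes the coefficient of `f` the square of `4 * K`.
        ≤⟨ ^-monoˡ-≤ (2 * j) (≤-trans (*-monoˡ-≤ (K * K * f) (m≤m+n 12 4)) (≤-reflexive
             (solve 2 (λ K f → con 16 :* (K :* K :* f) := con 4 :* K :* (con 4 :* K :* con 1) :* f) refl
                   K f))) ⟩
      ((4 * K) ^ 2 * f) ^ (2 * j)
        ≡⟨ trans (^-distribʳ-* (2 * j) ((4 * K) ^ 2) f) (cong (_* f ^ (2 * j)) (^-*-assoc (4 * K) 2 (2 *
              j))) ⟩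
      (4 * K) ^ (2 * (2 * j)) * f ^ (2 * j)
        ≤⟨ *-mono-≤ (^-monoʳ-≤ (4 * K) {{m*n≢0 4 K}} (*-monoʳ-≤ 2 (2*⌊n/2⌋≤n K))) f≤ ⟩
      (4 * K) ^ (2 * K) * (2 * s) ^ (2 * K) ∎

open import Axiom.ExcludedMiddle using (ExcludedMiddle)
open import Data.Empty using (⊥-elim)
open import Data.Fin using (Fin)
import Data.Fin as Fin
import Data.Fin.Properties as Fin
open import Data.Fin.Subset using (Subset; _∈_; _∉_; _─_; ⊤; ∣_∣)
open import Data.Fin.Subset.Properties using (x∈p∧x∉q⇒x∈p─q)
import Data.Integer as ℤ
import Data.Integer.Properties as ℤₚ
open import Data.Integer using (+_)
open import Data.List using (List; []; _∷_; allFin)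
import Data.List as List
open import Data.List.Membership.Propositional.Properties using (∈-allFin)
open import Data.List.Properties using (length-tabulate; length-reverse)
open import Data.List.Relation.Unary.All using (All; []; _∷_)
import Data.List.Relation.Unary.All as All
import Data.List.Relation.Unary.Any.Properties as Any
open import Data.Nat using (ℕ; zero; suc; NonZero; _∸_)
import Data.Nat as ℕ
import Data.Nat.Properties as ℕₚ
open import Data.Nat.Divisibility using (_∣_; _∣?_; divides)
open import Data.Product using (∃; _×_; _,_; proj₁; proj₂)
open import Data.Rational using (ℚ; 0ℚ; 1ℚ; ½; _/_; 1/_)
import Data.Rational as ℚ
import Data.Rational.Properties as ℚₚ
open import Data.Rational.Solver using (module +-*-Solver)
open import Data.Rational.Unnormalised using (mkℚᵘ)
import Data.Rational.Unnormalised as ℚᵘ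
import Data.Rational.Unnormalised.Properties as ℚᵘₚ
open import Data.Sum using (_⊎_; inj₁; inj₂; swap; map₂)
open import Data.Vec using (_∷_; there)
open import Data.Bool using (true; false; if_then_else_)
open import Function using (_∘_)
open import Level using (0ℓ)
open import Relation.Binary.Definitions using (tri<; tri≈; tri>)
open import Relation.Binary.PropositionalEquality
open import Relation.Nullary using (¬_; yes; no; Dec; does)
open import Defs

open Summation
open TrailCounting
open GreedySpanner
open Roots

-- From inequalities of natural numbers to inequalities of cuts

⟦_⟧ : ℕ → ℚ
⟦ a ⟧ = + a / 1

⟦⟧≃ : ∀ a → ℚ.toℚᵘ ⟦ a ⟧ ℚᵘ.≃ mkℚᵘ (+ a) 0
⟦⟧≃ a = ℚₚ.toℚᵘ-fromℚᵘ (mkℚᵘ (+ a) 0)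

-- Equality of reduced fractions is checked on unreduced ones, where it is an identity of integers.
⟦⟧-+ : ∀ a b → ⟦ a ℕ.+ b ⟧ ≡ ⟦ a ⟧ ℚ.+ ⟦ b ⟧
⟦⟧-+ a b = ℚₚ.toℚᵘ-injective (begin
  ℚ.toℚᵘ ⟦ a ℕ.+ b ⟧                 ≈⟨ ⟦⟧≃ (a ℕ.+ b) ⟩
  mkℚᵘ (+ (a ℕ.+ b)) 0               ≈⟨ ℚᵘ.*≡* (cong (λ z → z ℤ.* + 1) (cong₂ ℤ._+_ (sym (ℤₚ.*-identityʳ
        (+ a))) (sym (ℤₚ.*-identityʳ (+ b))))) ⟩
  mkℚᵘ (+ a) 0 ℚᵘ.+ mkℚᵘ (+ b) 0     ≈⟨ ℚᵘₚ.+-cong (⟦⟧≃ a) (⟦⟧≃ b) ⟨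
  ℚ.toℚᵘ ⟦ a ⟧ ℚᵘ.+ ℚ.toℚᵘ ⟦ b ⟧     ≈⟨ ℚₚ.toℚᵘ-homo-+ ⟦ a ⟧ ⟦ b ⟧ ⟨
  ℚ.toℚᵘ (⟦ a ⟧ ℚ.+ ⟦ b ⟧)           ∎)
  where open ℚᵘₚ.≃-Reasoning

⟦⟧-* : ∀ a b → ⟦ a ℕ.* b ⟧ ≡ ⟦ a ⟧ ℚ.* ⟦ b ⟧
⟦⟧-* a b = ℚₚ.toℚᵘ-injective (begin
  ℚ.toℚᵘ ⟦ a ℕ.* b ⟧                 ≈⟨ ⟦⟧≃ (a ℕ.* b) ⟩
  mkℚᵘ (+ (a ℕ.* b)) 0               ≈⟨ ℚᵘ.*≡* (cong (λ z → z ℤ.* + 1) (ℤₚ.pos-* a b)) ⟩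
  mkℚᵘ (+ a) 0 ℚᵘ.* mkℚᵘ (+ b) 0     ≈⟨ ℚᵘₚ.*-cong (⟦⟧≃ a) (⟦⟧≃ b) ⟨
  ℚ.toℚᵘ ⟦ a ⟧ ℚᵘ.* ℚ.toℚᵘ ⟦ b ⟧     ≈⟨ ℚₚ.toℚᵘ-homo-* ⟦ a ⟧ ⟦ b ⟧ ⟨
  ℚ.toℚᵘ (⟦ a ⟧ ℚ.* ⟦ b ⟧)           ∎)
  where open ℚᵘₚ.≃-Reasoning

⟦⟧-^ : ∀ a q → ⟦ a ℕ.^ q ⟧ ≡ ⟦ a ⟧ ^ q
⟦⟧-^ a zero    = refl
⟦⟧-^ a (suc q) = trans (⟦⟧-* a (a ℕ.^ q)) (cong (⟦ a ⟧ ℚ.*_) (⟦⟧-^ a q))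

0≤⟦⟧ : ∀ a → 0ℚ ℚ.≤ ⟦ a ⟧
0≤⟦⟧ a = ℚₚ.nonNegative⁻¹ _ {{ℚₚ.normalize-nonNeg a 1}}

⟦⟧-mono-≤ : ∀ {a b} → a ℕ.≤ b → ⟦ a ⟧ ℚ.≤ ⟦ b ⟧
⟦⟧-mono-≤ {a} {b} a≤b = subst₂ ℚ._≤_ (ℚₚ.+-identityʳ ⟦ a ⟧)
  (trans (sym (⟦⟧-+ a (b ℕ.∸ a))) (cong ⟦_⟧ (ℕₚ.m+[n∸m]≡n a≤b)))
  (ℚₚ.+-monoʳ-≤ ⟦ a ⟧ (0≤⟦⟧ (b ℕ.∸ a)))

0<1 : 0ℚ ℚ.< 1ℚ
0<1 = ℚₚ.positive⁻¹ 1ℚ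

0<⟦⟧ : ∀ {a} → 1 ℕ.≤ a → 0ℚ ℚ.< ⟦ a ⟧
0<⟦⟧ 1≤a = ℚₚ.<-≤-trans 0<1 (⟦⟧-mono-≤ 1≤a)

half< : ∀ {p} → 0ℚ ℚ.< p → p ℚ.* ½ ℚ.< p
half< {p} 0<p = subst (p ℚ.* ½ ℚ.<_) (ℚₚ.*-identityʳ p)
  (ℚₚ.*-monoʳ-<-pos p {{ℚ.positive 0<p}} {½} {1ℚ} (ℚ.*<* (ℤ.+<+ (ℕ.s≤s (ℕ.s≤s ℕ.z≤n)))))

*-nonNeg : ∀ {p q} → 0ℚ ℚ.≤ p → 0ℚ ℚ.≤ q → 0ℚ ℚ.≤ p ℚ.* q
*-nonNeg {p} {q} 0≤p 0≤q = ℚₚ.nonNegative⁻¹ _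
  {{ℚₚ.nonNeg*nonNeg⇒nonNeg p {{ℚ.nonNegative 0≤p}} q {{ℚ.nonNegative 0≤q}}}}

+-nonNeg : ∀ {p q} → 0ℚ ℚ.≤ p → 0ℚ ℚ.≤ q → 0ℚ ℚ.≤ p ℚ.+ q
+-nonNeg = ℚₚ.+-mono-≤

0≤½ : 0ℚ ℚ.≤ ½
0≤½ = ℚₚ.nonNegative⁻¹ ½

-- A cut contains only rationals strictly below its value, so a positive `a` is not a witness in its
-- own cut; its half is a uniform choice that is.
halfℕ : ℕ → ℚ
halfℕ a = ⟦ a ⟧ ℚ.* ½

0≤halfℕ : ∀ a → 0ℚ ℚ.≤ halfℕ a
0≤halfℕ a = *-nonNeg (0≤⟦⟧ a) 0≤½

lower-fromℕ : ∀ {a} → 1 ℕ.≤ a → lower (fromℕ a) (halfℕ a)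
lower-fromℕ 1≤a = half< (0<⟦⟧ 1≤a)

lower-root : ∀ {a p s} q .{{_ : NonZero q}} → 1 ℕ.≤ s → s ℕ.^ q ℕ.≤ a ℕ.^ p → lower (a ^[ p / q ]) (halfℕ s)
lower-root {s = s} (suc q) 1≤s s^q≤ = ⟦ s ⟧ , 0≤⟦⟧ s
  , subst (ℚ._≤ _) (⟦⟧-^ s (suc q)) (⟦⟧-mono-≤ s^q≤) , half< (0<⟦⟧ 1≤s)

lower-* : ∀ x y {s t} → 0ℚ ℚ.≤ s → 0ℚ ℚ.≤ t → lower x s → lower y t → lower (x * y) (s ℚ.* t)
lower-* x y 0≤s 0≤t s∈ t∈ = inj₂ (_ , _ , 0≤s , 0≤t , s∈ , t∈ , ℚₚ.≤-refl)

-- 4096 = 256 · 2³ · 2: in the main term each of the three factors is replaced by its half, and so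
-- is the constant itself.
C₀ : ℝ≥0
C₀ = record { value = fromℕ 4096 ; finite = ⟦ 4096 ⟧ , ℚₚ.<-irrefl refl }

-- Floors of roots are within a factor 2 of the roots, and each factor is approximated from
-- below by half of a natural number: the constant 4096 absorbs all these losses.
real-bound : ∀ {h k′ z s t X Y} → 1 ℕ.≤ k′ → 1 ℕ.≤ z → lower X (halfℕ s) → lower Y (halfℕ t) →
  h ℕ.≤ 256 ℕ.* (k′ ℕ.* s ℕ.* t) ⊎ h ℕ.≤ 32 ℕ.* z →
  fromℕ h ≤ value C₀ * (fromℕ k′ * X * Y + fromℕ z)
real-bound {h} {k′} {z} {s} {t} {X} {Y} 1≤k 1≤z s∈ t∈ h≤ q q<h = inj₂
  ( halfℕ 4096 , A ℚ.+ halfℕ z , 0≤halfℕ 4096 , +-nonNeg 0≤A (0≤halfℕ z)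
  , lower-fromℕ {4096} (ℕ.s≤s ℕ.z≤n)
  , (A , halfℕ z , lower-* (fromℕ k′ * X) Y (*-nonNeg (0≤halfℕ k′) (0≤halfℕ s)) (0≤halfℕ t)
       (lower-* (fromℕ k′) X (0≤halfℕ k′) (0≤halfℕ s) (lower-fromℕ {k′} 1≤k) s∈) t∈ , lower-fromℕ {z} 1≤z
             , refl)
  , ℚₚ.≤-trans (ℚₚ.<⇒≤ q<h) (bound h≤) )
  where
  open ℚₚ.≤-Reasoning
  open +-*-Solver using (solve; _:=_; con; _:*_)
  A = halfℕ k′ ℚ.* halfℕ s ℚ.* halfℕ t
  0≤A : 0ℚ ℚ.≤ A
  0≤A = *-nonNeg (*-nonNeg (0≤halfℕ k′) (0≤halfℕ s)) (0≤halfℕ t)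
  scale : ∀ {p q} → p ℚ.≤ q → halfℕ 4096 ℚ.* p ℚ.≤ halfℕ 4096 ℚ.* q
  scale = ℚₚ.*-monoˡ-≤-nonNeg (halfℕ 4096) {{ℚ.nonNegative (0≤halfℕ 4096)}}
  bound : _ → ⟦ h ⟧ ℚ.≤ halfℕ 4096 ℚ.* (A ℚ.+ halfℕ z)
  bound (inj₁ h≤) = begin
    ⟦ h ⟧
      ≤⟨ ⟦⟧-mono-≤ h≤ ⟩
    ⟦ 256 ℕ.* (k′ ℕ.* s ℕ.* t) ⟧
      ≡⟨ trans (⟦⟧-* 256 (k′ ℕ.* s ℕ.* t)) (cong (⟦ 256 ⟧ ℚ.*_) (trans (⟦⟧-* (k′ ℕ.* s) t) (cong (ℚ._* ⟦
            t ⟧) (⟦⟧-* k′ s)))) ⟩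
    ⟦ 256 ⟧ ℚ.* (⟦ k′ ⟧ ℚ.* ⟦ s ⟧ ℚ.* ⟦ t ⟧)
      ≡⟨ solve 3 (λ a b c → con ⟦ 256 ⟧ :* (a :* b :* c) := con (halfℕ 4096) :* (a :* con ½ :* (b :* con
            ½) :* (c :* con ½))) refl ⟦ k′ ⟧ ⟦ s ⟧ ⟦ t ⟧ ⟩
    halfℕ 4096 ℚ.* A
      ≤⟨ scale (subst (ℚ._≤ A ℚ.+ halfℕ z) (ℚₚ.+-identityʳ A) (ℚₚ.+-monoʳ-≤ A (0≤halfℕ z))) ⟩
    halfℕ 4096 ℚ.* (A ℚ.+ halfℕ z) ∎
  bound (inj₂ h≤) = begin
    ⟦ h ⟧
      ≤⟨ ⟦⟧-mono-≤ (ℕₚ.≤-trans h≤ (ℕₚ.*-monoˡ-≤ z (ℕₚ.m≤m+n 32 992))) ⟩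
    ⟦ 1024 ℕ.* z ⟧
      ≡⟨ ⟦⟧-* 1024 z ⟩
    ⟦ 1024 ⟧ ℚ.* ⟦ z ⟧
      ≡⟨ solve 1 (λ a → con ⟦ 1024 ⟧ :* a := con (halfℕ 4096) :* (a :* con ½)) refl ⟦ z ⟧ ⟩
    halfℕ 4096 ℚ.* halfℕ z
      ≤⟨ scale (subst (ℚ._≤ A ℚ.+ halfℕ z) (ℚₚ.+-identityˡ (halfℕ z)) (ℚₚ.+-monoˡ-≤ (halfℕ z) 0≤A)) ⟩
    halfℕ 4096 ℚ.* (A ℚ.+ halfℕ z) ∎

-- Ranking the edges by weight, and the stretch of distances

module Weighted (em : ExcludedMiddle 0ℓ) {n} (G : Graph n) (w : Fin (size G) → ℝ≥0) where

  open Indicator em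
  open Walks G

  private m = size G

  -- A rational that lies in one cut but not in the other bounds all elements of the other, as cuts
  -- are closed downwards.
  ≤-total : ∀ x y → x ≤ y ⊎ y ≤ x
  ≤-total x y with em {∃ λ q → lower x q × ¬ lower y q}
  ... | no none = inj₁ λ q q∈ → below q q∈
    where
    below : ∀ q → lower x q → lower y q
    below q q∈ with em {lower y q}
    ... | yes p = p
    ... | no ¬p = ⊥-elim (none (q , q∈ , ¬p))
  ... | yes (q , q∈ , q∉) = inj₂ below
    where
    below : ∀ p → lower y p → lower x p
    below p p∈ with ℚₚ.<-cmp p q
    ... | tri< p<q _ _  = closed x p<q q∈
    ... | tri≈ _ refl _ = q∈
    ... | tri> _ _ q<p  = ⊥-elim (q∉ (closed y q<p p∈))

  weight : E → ℝ≥0∞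
  weight e = value (w e)

  -- Comparison of weights, with ties broken by the index.
  _≺_ : E → E → Set
  e ≺ x = weight e ≤ weight x × (weight x ≤ weight e → e Fin.< x)

  ≺-irrefl : ∀ {e} → ¬ e ≺ e
  ≺-irrefl (e≤ , e<) = Fin.<-irrefl refl (e< e≤)

  ≺-trans : ∀ {e x y} → e ≺ x → x ≺ y → e ≺ y
  ≺-trans (e≤x , e<x) (x≤y , x<y) = (λ q → x≤y q ∘ e≤x q)
    , λ y≤e → Fin.<-trans (e<x λ q → y≤e q ∘ x≤y q) (x<y λ q → e≤x q ∘ y≤e q)

  ≺-connex : ∀ {e x} → e ≢ x → e ≺ x ⊎ x ≺ e
  ≺-connex {e} {x} e≢x with Fin.<-cmp e x | em {weight e ≤ weight x} | em {weight x ≤ weight e}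
  ... | tri≈ _ e≡x _ | _      | _      = ⊥-elim (e≢x e≡x)
  ... | tri< e<x _ _ | yes e≤ | _      = inj₁ (e≤ , λ _ → e<x)
  ... | tri> _ _ x<e | _      | yes x≤ = inj₂ (x≤ , λ _ → x<e)
  ... | _            | yes e≤ | no x≰  = inj₁ (e≤ , ⊥-elim ∘ x≰)
  ... | _            | no e≰  | yes x≤ = inj₂ (x≤ , ⊥-elim ∘ e≰)
  ... | _            | no e≰  | no x≰ with ≤-total (weight e) (weight x)
  ...   | inj₁ e≤ = ⊥-elim (e≰ e≤)
  ...   | inj₂ x≤ = ⊥-elim (x≰ x≤)

  -- Counting predecessors turns the weights into distinct natural numbers in a compatible order,
  -- which is all that the greedy construction and the counting of trails compare.
  rank : E → ℕ
  rank e = ∑ (allFin m) (λ x → ι (x ≺ e))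

  rank-mono : ∀ {e x} → e ≺ x → rank e ℕ.< rank x
  rank-mono {e} {x} e≺x = ∑-mono-< (allFin m) (λ y → ι-mono λ y≺e → ≺-trans y≺e e≺x) (∈-allFin e)
    (subst₂ ℕ._<_ (sym (ι-no ≺-irrefl)) (sym (ι-yes e≺x)) (ℕ.s≤s ℕ.z≤n))

  rank≤m : ∀ e → rank e ℕ.≤ m
  rank≤m e = begin
    rank e                     ≤⟨ ∑-mono (allFin m) (λ x → ι≤1) ⟩
    ∑ (allFin m) (λ _ → 1)     ≡⟨ ∑-const (allFin m) 1 ⟩
    List.length (allFin m) ℕ.* 1 ≡⟨ trans (ℕₚ.*-identityʳ _) (length-tabulate _) ⟩
    m                          ∎
    where open ℕₚ.≤-Reasoning

  rank-injective : ∀ {e x} → rank e ≡ rank x → e ≡ x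
  rank-injective {e} {x} eq with em {e ≡ x}
  ... | yes e≡x = e≡x
  ... | no e≢x with ≺-connex e≢x
  ...   | inj₁ e≺x = ⊥-elim (ℕₚ.<-irrefl eq (rank-mono e≺x))
  ...   | inj₂ x≺e = ⊥-elim (ℕₚ.<-irrefl (sym eq) (rank-mono x≺e))

  rank≤⇒weight≤ : ∀ {e x} → rank e ℕ.≤ rank x → weight e ≤ weight x
  rank≤⇒weight≤ {e} {x} r≤ with em {e ≡ x}
  ... | yes refl = λ _ q∈ → q∈
  ... | no e≢x with ≺-connex e≢x
  ...   | inj₁ (e≤x , _) = e≤x
  ...   | inj₂ x≺e = ⊥-elim (ℕₚ.<⇒≱ (rank-mono x≺e) r≤)

  infixr 5 _++_
  _++_ : ∀ {S u v t} → Walk G S u v → Walk G S v t → Walk G S u t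
  []             ++ σ = σ
  step e e∈ j π ++ σ = step e e∈ j (π ++ σ)

  length-++ : ∀ {S u v t} (π : Walk G S u v) (σ : Walk G S v t) →
    length G w (π ++ σ) ≤ length G w π + length G w σ
  -- The length 0 of the empty walk contains only negative rationals, so `q` needs a larger element
  -- `r` of the other cut, which roundedness supplies.
  length-++ [] σ q q∈ = let r , q<r , r∈ = rounded (length G w σ) q∈ in
    q ℚ.- r , r , subst (q ℚ.- r ℚ.<_) (ℚₚ.+-inverseʳ r) (ℚₚ.+-monoˡ-< (ℚ.- r) q<r) , r∈
    , solve 2 (λ q r → q := q :+ :- r :+ r) refl q r
    where open +-*-Solver using (solve; _:=_; _:+_; :-_)
  length-++ (step e _ _ π) σ q (s₁ , s₂ , s₁∈ , s₂∈ , refl) with length-++ π σ s₂ s₂∈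
  ... | a , b , a∈ , b∈ , refl = s₁ ℚ.+ a , b , (s₁ , a , s₁∈ , a∈ , refl) , b∈ , sym (ℚₚ.+-assoc s₁ a b)

  -- The bound of the length by the number of edges times `x` is expressed through rationals `ρ`
  -- outside the cut `x`, that is, upper bounds of `x`; this avoids a product of cuts. Strictness
  -- originates in the empty walk.
  walk : ∀ {S u v x} τ → Run u τ v → All (λ e → e ∈ S × weight e ≤ x) τ →
    ∃ λ (π : Walk G S u v) → ∀ {ρ s} → ¬ lower x ρ → lower (length G w π) s →
      s ℚ.< ⟦ List.length τ ⟧ ℚ.* ρ
  walk [] refl [] = [] , λ {ρ} {s} _ s<0 → subst (s ℚ.<_) (sym (ℚₚ.*-zeroˡ ρ)) s<0
  walk {x = x} (e ∷ τ) (v , j , run) ((e∈ , e≤x) ∷ all) with π , bound ← walk {x = x} τ run all =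
    step e e∈ j π , longer
    where
    longer : ∀ {ρ s} → ¬ lower x ρ → lower (length G w (step e e∈ j π)) s →
      s ℚ.< ⟦ suc (List.length τ) ⟧ ℚ.* ρ
    longer {ρ} ρ∉ (s₁ , s₂ , s₁∈ , s₂∈ , refl) = subst (s₁ ℚ.+ s₂ ℚ.<_) eq
      (ℚₚ.+-mono-≤-< (ℚₚ.≮⇒≥ λ ρ<s₁ → ρ∉ (closed x ρ<s₁ (e≤x s₁ s₁∈))) (bound ρ∉ s₂∈))
      where
      eq : ρ ℚ.+ ⟦ List.length τ ⟧ ℚ.* ρ ≡ ⟦ suc (List.length τ) ⟧ ℚ.* ρ
      eq = trans (cong (ℚ._+ ⟦ List.length τ ⟧ ℚ.* ρ) (sym (ℚₚ.*-identityˡ ρ)))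
        (trans (sym (ℚₚ.*-distribʳ-+ ρ 1ℚ ⟦ List.length τ ⟧)) (cong (ℚ._* ρ) (sym (⟦⟧-+ 1 (List.length τ)))))

  module Stretch (M : ℚ) (0<M : 0ℚ ℚ.< M) {S T : Subset m}
    (detour : ∀ {e u v} → e ∈ T → Joins G e u v →
      ∃ λ τ → Run u τ v × ⟦ List.length τ ⟧ ℚ.≤ M × All (λ x → x ∈ S × weight x ≤ weight e) τ) where

    private instance
      M>0 : ℚ.Positive M
      M>0 = ℚ.positive 0<M
      M≢0 : ℚ.NonZero M
      M≢0 = ℚₚ.pos⇒nonZero M

    M⁻¹ : ℚ
    M⁻¹ = 1/ M

    private instance
      M⁻¹>0 : ℚ.Positive M⁻¹
      M⁻¹>0 = ℚₚ.1/pos⇒pos M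

    M*[q*M⁻¹] : ∀ q → M ℚ.* (q ℚ.* M⁻¹) ≡ q
    M*[q*M⁻¹] q = trans (cong (M ℚ.*_) (ℚₚ.*-comm q M⁻¹)) (trans (sym (ℚₚ.*-assoc M M⁻¹ q))
      (trans (cong (ℚ._* q) (ℚₚ.*-inverseʳ M)) (ℚₚ.*-identityˡ q)))

    *M⁻¹-< : ∀ {p q} → p ℚ.< q → p ℚ.* M⁻¹ ℚ.< q ℚ.* M⁻¹
    *M⁻¹-< = ℚₚ.*-monoˡ-<-pos M⁻¹

    <0⇒*M⁻¹<0 : ∀ {q} → q ℚ.< 0ℚ → q ℚ.* M⁻¹ ℚ.< 0ℚ
    <0⇒*M⁻¹<0 {q} q<0 = subst (q ℚ.* M⁻¹ ℚ.<_) (ℚₚ.*-zeroˡ M⁻¹) (*M⁻¹-< q<0)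

    0≤⇒0≤*M⁻¹ : ∀ {q} → 0ℚ ℚ.≤ q → 0ℚ ℚ.≤ q ℚ.* M⁻¹
    0≤⇒0≤*M⁻¹ 0≤q = *-nonNeg 0≤q (ℚₚ.<⇒≤ (ℚₚ.positive⁻¹ M⁻¹))

    -- If s/M were outside the cut, it could serve as `ρ`, and s < j · s/M ≤ s would follow.
    *M⁻¹-lower : ∀ {x s} j → ⟦ j ⟧ ℚ.≤ M → (∀ {ρ} → ¬ lower x ρ → s ℚ.< ⟦ j ⟧ ℚ.* ρ) → lower x (s ℚ.* M⁻¹)
    *M⁻¹-lower {x} {s} j j≤M bound with em {lower x (s ℚ.* M⁻¹)}
    ... | yes p = p
    ... | no ρ∉ = ⊥-elim (ℚₚ.<-irrefl refl (begin-strict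
      s                      <⟨ bound ρ∉ ⟩
      ⟦ j ⟧ ℚ.* (s ℚ.* M⁻¹)   ≤⟨ ℚₚ.*-monoʳ-≤-nonNeg (s ℚ.* M⁻¹) {{ℚ.nonNegative 0≤ρ}} j≤M ⟩
      M ℚ.* (s ℚ.* M⁻¹)       ≡⟨ M*[q*M⁻¹] s ⟩
      s                      ∎))
      where
      open ℚₚ.≤-Reasoning
      0≤ρ : 0ℚ ℚ.≤ s ℚ.* M⁻¹
      0≤ρ = ℚₚ.≮⇒≥ λ ρ<0 → ρ∉ (negative x ρ<0)

    edge-detour : ∀ {e u v} → e ∈ T → Joins G e u v → ∃ λ (π : Walk G S u v) →
      ∀ s → lower (length G w π) s → lower (weight e) (s ℚ.* M⁻¹)
    edge-detour {e} e∈ j =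
      let τ , run , len , all = detour e∈ j
          π , bound = walk {x = weight e} τ run all
      in π , λ s s∈ → *M⁻¹-lower {weight e} (List.length τ) len (λ ρ∉ → bound ρ∉ s∈)

    -- Dividing the rationals by `M`, instead of multiplying the cut, makes the bound additive, so
    -- the detours of the single edges can be concatenated.
    reroute : ∀ {u v} (π : Walk G T u v) → ∃ λ (σ : Walk G S u v) →
      ∀ s → lower (length G w σ) s → lower (length G w π) (s ℚ.* M⁻¹)
    reroute [] = [] , λ s → <0⇒*M⁻¹<0
    reroute (step e e∈ j π) =
      let σ₁ , bound₁ = edge-detour e∈ j
          σ₂ , bound₂ = reroute π
      in σ₁ ++ σ₂ , λ s s∈ → let s₁ , s₂ , s₁∈ , s₂∈ , eq = length-++ σ₁ σ₂ s s∈ in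
        s₁ ℚ.* M⁻¹ , s₂ ℚ.* M⁻¹ , bound₁ s₁ s₁∈ , bound₂ s₂ s₂∈
        , trans (cong (ℚ._* M⁻¹) eq) (ℚₚ.*-distribʳ-+ M⁻¹ s₁ s₂)

    dist-≤ : ∀ x → (∀ {q} → q ℚ.< M → lower x q) → ∀ u v → dist G w S u v ≤ x * dist G w T u v
    dist-≤ x M≤x u v q (s , q<s , s∈) with q ℚ.<? 0ℚ
    ... | yes q<0 = inj₁ q<0
    -- The gap between `q` and `s` in the infimum is spent twice: ρ < s/M puts `ρ` below the
    -- distance in `T`, and ρ > q/M makes the other factor q/ρ smaller than `M`.
    ... | no q≮0 with ρ , q/M<ρ , ρ<s/M ← ℚₚ.<-dense (*M⁻¹-< q<s) = inj₂
      ( q ℚ.* 1/ρ , ρ , *-nonNeg 0≤q (ℚₚ.<⇒≤ (ℚₚ.positive⁻¹ 1/ρ)) , ℚₚ.<⇒≤ 0<ρ , M≤x σ<M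
      , (s ℚ.* M⁻¹ , ρ<s/M , λ π → let σ , bound = reroute π in bound s (s∈ σ))
      , ℚₚ.≤-reflexive (sym cancel) )
      where
      0≤q = ℚₚ.≮⇒≥ q≮0
      0<ρ = ℚₚ.≤-<-trans (0≤⇒0≤*M⁻¹ 0≤q) q/M<ρ
      instance
        ρ>0 : ℚ.Positive ρ
        ρ>0 = ℚ.positive 0<ρ
        ρ≢0 : ℚ.NonZero ρ
        ρ≢0 = ℚₚ.pos⇒nonZero ρ
      1/ρ = 1/ ρ
      instance
        1/ρ>0 : ℚ.Positive 1/ρ
        1/ρ>0 = ℚₚ.1/pos⇒pos ρ
      cancel : q ℚ.* 1/ρ ℚ.* ρ ≡ q
      cancel = trans (ℚₚ.*-assoc q 1/ρ ρ) (trans (cong (q ℚ.*_) (ℚₚ.*-inverseˡ ρ)) (ℚₚ.*-identityʳ q))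
      σ<M : q ℚ.* 1/ρ ℚ.< M
      σ<M = ℚₚ.*-cancelʳ-<-nonNeg ρ {{ℚₚ.pos⇒nonNeg ρ}} (begin-strict
        q ℚ.* 1/ρ ℚ.* ρ       ≡⟨ cancel ⟩
        q                     ≡⟨ M*[q*M⁻¹] q ⟨
        M ℚ.* (q ℚ.* M⁻¹)  <⟨ ℚₚ.*-monoʳ-<-pos M q/M<ρ ⟩
        M ℚ.* ρ            ∎)
        where open ℚₚ.≤-Reasoning

∈─⁻ : ∀ {m} (p q : Subset m) {x} → x ∈ p ─ q → x ∉ q
∈─⁻ (_ ∷ p)     (true  ∷ q) {Fin.zero}  ()
∈─⁻ (_ ∷ p)     (false ∷ q) {Fin.zero}  _ ()
∈─⁻ (_ ∷ p)     (_     ∷ q) {Fin.suc x} (there x∈) (there x∈q) = ∈─⁻ p q x∈ x∈q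

-- The size bound in both parities

even-half : ∀ q → ℕ.⌊ q ℕ.* 2 /2⌋ ≡ q
even-half zero    = refl
even-half (suc q) = cong suc (even-half q)

2⌊n/2⌋≡n : ∀ {n} q → n ≡ q ℕ.* 2 → 2 ℕ.* ℕ.⌊ n /2⌋ ≡ n
2⌊n/2⌋≡n q refl = trans (cong (2 ℕ.*_) (even-half q)) (ℕₚ.*-comm 2 q)

2⌊n/2⌋≡n∸1 : ∀ {n} → ¬ 2 ∣ n → 2 ℕ.* ℕ.⌊ n /2⌋ ≡ n ℕ.∸ 1
2⌊n/2⌋≡n∸1 {n} odd with 2*⌊n/2⌋ n
... | inj₁ eq = ⊥-elim (odd (divides ℕ.⌊ n /2⌋ (trans (sym eq) (ℕₚ.*-comm 2 ℕ.⌊ n /2⌋))))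
... | inj₂ eq = cong ℕ.pred eq

sizeBound-≤ : ∀ {n f h} k (let K = suc k) .{{_ : NonZero n}} .{{_ : NonZero f}} →
  h ℕ.≤ 32 ℕ.* (K ℕ.* f ℕ.* n) ⊎
    h ℕ.^ K ℕ.≤ (16 ℕ.* (K ℕ.* n)) ℕ.^ K ℕ.* (n ℕ.* (12 ℕ.* (K ℕ.* K ℕ.* f)) ℕ.^ ℕ.⌊ K /2⌋) →
  fromℕ h ≤ sizeBound C₀ n f K
sizeBound-≤ {n} {f} {h} k cases = by-parity (2 ∣? K)
  where
  open ℕₚ.≤-Reasoning
  K = suc k
  instance
    Kf≢0 : NonZero (K ℕ.* f)
    Kf≢0 = ℕₚ.m*n≢0 K f
    Kfn≢0 : NonZero (K ℕ.* f ℕ.* n)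
    Kfn≢0 = ℕₚ.m*n≢0 (K ℕ.* f) n
    n^≢0 : NonZero (n ℕ.^ (K ℕ.+ 1))
    n^≢0 = ℕₚ.m^n≢0 n (K ℕ.+ 1)
    f^≢0 : NonZero (f ℕ.^ (K ℕ.∸ 1))
    f^≢0 = ℕₚ.m^n≢0 f (K ℕ.∸ 1)

  bound : ∀ {X s} → lower X (halfℕ s) → f ℕ.^ (2 ℕ.* ℕ.⌊ K /2⌋) ℕ.≤ (2 ℕ.* s) ℕ.^ (2 ℕ.* K) →
    fromℕ h ≤ value C₀ * (fromℕ (K ℕ.^ 2) * X * n ^[ K ℕ.+ 1 / K ] + fromℕ (K ℕ.* f ℕ.* n))
  bound {X} {s} s∈ f≤ =
    let t , 1≤t , t≤ , n≤ = root K (n ℕ.^ (K ℕ.+ 1)) in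
    real-bound {k′ = K ℕ.^ 2} {K ℕ.* f ℕ.* n} {s} {t} {X} {n ^[ K ℕ.+ 1 / K ]} (ℕ.>-nonZero⁻¹ (K ℕ.^ 2))
          (ℕ.>-nonZero⁻¹ (K ℕ.* f ℕ.* n)) s∈ (lower-root {n} {K ℕ.+ 1} {t} K 1≤t t≤)
      (swap (map₂ (λ h^K≤ → root-bound {n = n} {f} {s} {t} K h^K≤ n≤ f≤) cases))

  by-parity : (d : Dec (2 ∣ K)) → fromℕ h ≤ (if does d
    then value C₀ * (fromℕ (K ℕ.^ 2) * f ^[ 1 / 2 ] * n ^[ K ℕ.+ 1 / K ] + fromℕ (K ℕ.* f ℕ.* n))
    else value C₀ * (fromℕ (K ℕ.^ 2) * f ^[ K ℕ.∸ 1 / 2 ℕ.* K ] * n ^[ K ℕ.+ 1 / K ] + fromℕ (K ℕ.* f ℕ.* n)))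
  -- For even `K` the square root of `f` is approximated and then raised to the power `K`, as 2⌊K/2⌋
  -- = K. For odd `K` the exponent 2⌊K/2⌋ = K - 1 calls for the 2K-th root of f^(K - 1).
  by-parity (yes (divides q K≡)) =
    let s , 1≤s , s≤ , f≤ = root 2 f in
    bound {f ^[ 1 / 2 ]} {s} (lower-root {f} {1} {s} 2 1≤s (ℕₚ.≤-trans s≤ (ℕₚ.≤-reflexive (sym
          (ℕₚ.*-identityʳ f)))))
      (subst (λ l → f ℕ.^ l ℕ.≤ (2 ℕ.* s) ℕ.^ (2 ℕ.* K)) (sym (2⌊n/2⌋≡n q K≡))
        (ℕₚ.≤-trans (ℕₚ.^-monoˡ-≤ K f≤) (ℕₚ.≤-reflexive (ℕₚ.^-*-assoc (2 ℕ.* s) 2 K))))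
  by-parity (no odd) =
    let s , 1≤s , s≤ , f≤ = root (2 ℕ.* K) (f ℕ.^ (K ℕ.∸ 1)) in
    bound {f ^[ K ℕ.∸ 1 / 2 ℕ.* K ]} {s} (lower-root {f} {K ℕ.∸ 1} {s} (2 ℕ.* K) 1≤s s≤)
      (subst (λ l → f ℕ.^ l ℕ.≤ (2 ℕ.* s) ℕ.^ (2 ℕ.* K)) (sym (2⌊n/2⌋≡n∸1 odd)) f≤)

-- The spanner property and the conclusion

module Detours (em : ExcludedMiddle 0ℓ) {n} (G : Graph n) (w : Fin (size G) → ℝ≥0) (f k : ℕ)
  .{{_ : NonZero f}} where

  open Walks G
  open Weighted em G w
  open Spanner G rank em rank-injective f k

  private M = 2 ℕ.* suc k ∸ 1

  detour : ∀ {H F e u v} → Spans H e F → Joins G e u v →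
    ∃ λ τ → Run u τ v × ⟦ List.length τ ⟧ ℚ.≤ ⟦ M ⟧ × All (λ x → x ∈ H ─ F × weight x ≤ weight e) τ
  detour {H} {F} {e} {u} {v} (τ , run , len , all) = orient
    where
    light : All (λ x → x ∈ H ─ F × weight x ≤ weight e) τ
    light = All.map (λ (x∈ , x∉ , r≤) → x∈p∧x∉q⇒x∈p─q x∈ x∉ , rank≤⇒weight≤ r≤) all
    orient : Joins G e u v →
      ∃ λ τ → Run u τ v × ⟦ List.length τ ⟧ ℚ.≤ ⟦ M ⟧ × All (λ x → x ∈ H ─ F × weight x ≤ weight e) τ
    orient (inj₁ eq) = τ , subst₂ (λ u v → Run u τ v) (cong proj₁ eq) (cong proj₂ eq) run
      , ⟦⟧-mono-≤ {List.length τ} {M} (ℕ.s≤s⁻¹ len) , light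
    orient (inj₂ eq) = List.reverse τ
      , run-reverse τ (subst₂ (λ u v → Run u τ v) (cong proj₁ eq) (cong proj₂ eq) run)
      , ⟦⟧-mono-≤ {List.length (List.reverse τ)} {M}
          (subst (ℕ._≤ M) (sym (length-reverse τ)) (ℕ.s≤s⁻¹ len))
      , All.tabulate (All.lookup light ∘ Any.reverse⁻)

  -- It suffices to give every edge of `⊤ ─ F` a detour in `H ─ F`; the distances follow by
  -- rerouting walks edge by edge. The same detour serves both orientations of the edge after
  -- reversal.
  is-spanner : ∀ H → (∀ e F → rank e ℕ.< suc (size G) → ∣ F ∣ ℕ.≤ f → e ∉ F → Spans H e F) →
    IsEFTSpanner G w f (fromℕ M) H
  is-spanner H spans F F≤f = Stretch.dist-≤ ⟦ M ⟧ (0<⟦⟧ {M} (ℕₚ.≤-trans (ℕ.s≤s ℕ.z≤n) (ℕₚ.m≤n+m _ k)))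
    (λ {e} e∈ → detour (spans e F (ℕ.s≤s (rank≤m e)) F≤f (∈─⁻ ⊤ F e∈))) (fromℕ M) (λ q< → q<)

  spanner : .{{_ : NonZero n}} →
    ∃ λ H → IsEFTSpanner G w f (fromℕ M) H × fromℕ ∣ H ∣ ≤ sizeBound C₀ n f (suc k)
  -- Ranks are at most `size G`, so after this many rounds every edge has been examined.
  spanner = from (greedy (suc (size G)))
    where
    from : (∃ λ H → (∀ {e} → e ∈ H → rank e ℕ.< suc (size G)) ×
      (∀ e F → rank e ℕ.< suc (size G) → ∣ F ∣ ℕ.≤ f → e ∉ F → Spans H e F) ×
      (∀ e → e ∈ H → ∃ λ F → ∣ F ∣ ℕ.≤ f × Blocks H e F)) →
      ∃ λ H → IsEFTSpanner G w f (fromℕ M) H × fromℕ ∣ H ∣ ≤ sizeBound C₀ n f (suc k)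
    from (H , _ , spans , blocks) = H , is-spanner H spans , sizeBound-≤ {n} {f} {∣ H ∣} k
          (Size.size-bound H blocks)

0<C₀ : fromℕ 0 < value C₀
0<C₀ = 0ℚ , 0<⟦⟧ {4096} (ℕ.s≤s ℕ.z≤n) , ℚₚ.<-irrefl refl

theorem1p4 : ExcludedMiddle 0ℓ →
    ∃ λ (C : ℝ≥0) → fromℕ 0 < value C ×
    (∀ (n f k : ℕ) → .{{_ : NonZero n}} → .{{_ : NonZero f}} → .{{_ : NonZero k}} →
    (G : Graph n) (w : Fin (size G) → ℝ≥0) →
    ∃ λ (H : Subset (size G)) →
    IsEFTSpanner G w f (fromℕ (2 ℕ.* k ∸ 1)) H ×
    fromℕ ∣ H ∣ ≤ sizeBound C n f k)
theorem1p4 em = C₀ , 0<C₀ , λ where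
  n f zero    → ⊥-elim (ℕ.≢-nonZero⁻¹ 0 refl)
  n f (suc k) → λ G w → Detours.spanner em G w f k
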